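{- ${\sf VS}$ interprets Robinson's theory ${\sf R}$, i.e. ${\sf VS}\rhd {\sf R}$, via a one-dimensional interpretation.
   Context: ${\sf VS}$ (Vaught set theory) is the theory in the language $\{\in\}$ with axioms $\exists x\,\forall y\, y\notin x$ and, for every $n$, $\forall u_0\dots\forall u_{n-1}\,\exists x\,\forall y\,(y\in x\leftrightarrow \bigvee_{i<n} y=u_i)$ (no extensionality). ${\sf R}$ is the weak arithmetic of Tarski, Mostowski and Robinson (in the language with $0$, successor ${\sf S}$, $+$, $\times$, with $\leq$ defined by $x\le y:\leftrightarrow\exists z\,(z+x=y)$), axiomatized by the numeral equations for $+$ and $\times$, the inequalities between distinct numerals, and for each $n$: $x\le \underline n\to\bigvee_{k\le n}x=\underline k$ and $x\le\underline n\vee\underline n\le x$. -}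

module Defs where

open import Data.Nat using (ℕ; zero; suc; _+_; _*_)
open import Data.Fin using (Fin; zero; suc; _↑ˡ_; _↑ʳ_; toℕ)
import Data.Vec
open import Data.Vec using (Vec; []; _∷_; lookup)
open import Data.List using (List; []; _∷_; map)
open import Data.List.Membership.Propositional using (_∈_)
open import Data.List.Relation.Unary.All using (All)
open import Data.Product using (Σ; _×_; _,_)
open import Data.Unit using (⊤; tt)
open import Data.Empty using (⊥)
open import Relation.Binary.PropositionalEquality using (_≢_)

record Signature : Set₁ where
  field
    Fun   : Set
    funAr : Fun → ℕ
    Rel   : Set
    relAr : Rel → ℕ
open Signature public

data Term (L : Signature) (n : ℕ) : Set where
  var : Fin n → Term L n
  app : (f : Fun L) → Vec (Term L n) (funAr L f) → Term L n

infixr 5 _⇒_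
infix 7 _≐_

data Form (L : Signature) : ℕ → Set where
  ⊥'  : ∀ {n} → Form L n
  _≐_ : ∀ {n} → Term L n → Term L n → Form L n
  rel : ∀ {n} (r : Rel L) → Vec (Term L n) (relAr L r) → Form L n
  _⇒_ : ∀ {n} → Form L n → Form L n → Form L n
  ∀'  : ∀ {n} → Form L (suc n) → Form L n

module _ {L : Signature} where

  ¬' : ∀ {n} → Form L n → Form L n
  ¬' φ = φ ⇒ ⊥'

  ⊤' : ∀ {n} → Form L n
  ⊤' = ¬' ⊥'

  _∨'_ : ∀ {n} → Form L n → Form L n → Form L n
  φ ∨' ψ = ¬' φ ⇒ ψ

  _∧'_ : ∀ {n} → Form L n → Form L n → Form L n
  φ ∧' ψ = ¬' (φ ⇒ ¬' ψ)

  _⇔'_ : ∀ {n} → Form L n → Form L n → Form L n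
  φ ⇔' ψ = (φ ⇒ ψ) ∧' (ψ ⇒ φ)

  ∃' : ∀ {n} → Form L (suc n) → Form L n
  ∃' φ = ¬' (∀' (¬' φ))

  ⋁ : ∀ {n} k → (Fin k → Form L n) → Form L n
  ⋁ zero    φ = ⊥'
  ⋁ (suc k) φ = φ zero ∨' ⋁ k (λ i → φ (suc i))

  ⋀ : ∀ {n} k → (Fin k → Form L n) → Form L n
  ⋀ zero    φ = ⊤'
  ⋀ (suc k) φ = φ zero ∧' ⋀ k (λ i → φ (suc i))

  ∀ⁿ : ∀ k {m} → Form L (k + m) → Form L m
  ∀ⁿ zero    φ = φ
  ∀ⁿ (suc k) φ = ∀ⁿ k (∀' φ)

  ∀ᶜ : ∀ k → Form L k → Form L 0
  ∀ᶜ zero    φ = φ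
  ∀ᶜ (suc k) φ = ∀ᶜ k (∀' φ)

  ∃ⁿ : ∀ k {m} → Form L (k + m) → Form L m
  ∃ⁿ zero    φ = φ
  ∃ⁿ (suc k) φ = ∃ⁿ k (∃' φ)

  Sub : ℕ → ℕ → Set
  Sub m n = Fin m → Term L n

  mutual
    sub : ∀ {m n} → Sub m n → Term L m → Term L n
    sub σ (var i)    = σ i
    sub σ (app f ts) = app f (subs σ ts)

    subs : ∀ {m n k} → Sub m n → Vec (Term L m) k → Vec (Term L n) k
    subs σ []       = []
    subs σ (t ∷ ts) = sub σ t ∷ subs σ ts

  wkT : ∀ {n} → Term L n → Term L (suc n)
  wkT = sub (λ i → var (suc i))

  exts : ∀ {m n} → Sub m n → Sub (suc m) (suc n)
  exts σ zero    = var zero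
  exts σ (suc i) = wkT (σ i)

  subF : ∀ {m n} → Sub m n → Form L m → Form L n
  subF σ ⊥'         = ⊥'
  subF σ (t ≐ s)    = sub σ t ≐ sub σ s
  subF σ (rel r ts) = rel r (subs σ ts)
  subF σ (φ ⇒ ψ)    = subF σ φ ⇒ subF σ ψ
  subF σ (∀' φ)     = ∀' (subF (exts σ) φ)

  wk : ∀ {n} → Form L n → Form L (suc n)
  wk = subF (λ i → var (suc i))

  _[_] : ∀ {n} → Form L (suc n) → Term L n → Form L n
  φ [ t ] = subF σ φ
    where
    σ : Sub _ _
    σ zero    = t
    σ (suc i) = var i

  infix 3 _⊢_
  data _⊢_ : ∀ {n} → List (Form L n) → Form L n → Set where
    hyp   : ∀ {n} {Γ : List (Form L n)} {φ} → φ ∈ Γ → Γ ⊢ φ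
    ⇒I    : ∀ {n} {Γ : List (Form L n)} {φ ψ} → (φ ∷ Γ) ⊢ ψ → Γ ⊢ φ ⇒ ψ
    ⇒E    : ∀ {n} {Γ : List (Form L n)} {φ ψ} → Γ ⊢ φ ⇒ ψ → Γ ⊢ φ → Γ ⊢ ψ
    raa   : ∀ {n} {Γ : List (Form L n)} {φ} → (¬' φ ∷ Γ) ⊢ ⊥' → Γ ⊢ φ
    ∀I    : ∀ {n} {Γ : List (Form L n)} {φ} → map wk Γ ⊢ φ → Γ ⊢ ∀' φ
    ∀E    : ∀ {n} {Γ : List (Form L n)} {φ} → Γ ⊢ ∀' φ → (t : Term L n) → Γ ⊢ φ [ t ]
    refl≐ : ∀ {n} {Γ : List (Form L n)} (t : Term L n) → Γ ⊢ t ≐ t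
    subst≐ : ∀ {n} {Γ : List (Form L n)} {t s} (φ : Form L (suc n)) →
             Γ ⊢ t ≐ s → Γ ⊢ φ [ t ] → Γ ⊢ φ [ s ]
    -- the domain is nonempty: a fresh unused variable may be discharged
    close : ∀ {n} {Γ : List (Form L n)} {φ} → map wk Γ ⊢ wk φ → Γ ⊢ φ

Theory : Signature → Set₁
Theory L = Form L 0 → Set

_⊩_ : ∀ {L} → Theory L → Form L 0 → Set
_⊩_ {L} T φ = Σ (List (Form L 0)) λ Γ → All T Γ × (Γ ⊢ φ)

-- One-dimensional, parameter-free relative interpretations of L in M
-- (identity may be interpreted by an arbitrary formula).
--  dom     : domain formula δ(x₀)
--  eqI     : translation of x₀ = x₁
--  relI r  : translation of r(x₀,…,x_{k-1})
--  funI f  : graph of f: x₀ = f(x₁,…,x_k)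

record Translation (L M : Signature) : Set where
  field
    dom  : Form M 1
    eqI  : Form M 2
    relI : (r : Rel L) → Form M (relAr L r)
    funI : (f : Fun L) → Form M (suc (funAr L f))

module Translate {L M : Signature} (τ : Translation L M) where
  open Translation τ

  domAt : ∀ {n} → Term M n → Form M n
  domAt t = subF (λ _ → t) dom

  -- for formulas φⱼ (variable 0 = the value) produce, at level k + m,
  -- ⋀ⱼ (δ(yⱼ) ∧ φⱼ(yⱼ)) where yⱼ = variable (j ↑ˡ m)
  conjArgs : ∀ {k m} → Vec (Form M (suc m)) k → Form M (k + m)
  conjArgs {k} {m} φs = ⋀ k λ j →
      domAt (var (j ↑ˡ m)) ∧' subF (σ j) (lookup φs j)
    where
    σ : Fin k → Sub (suc m) (k + m)
    σ j zero    = var (j ↑ˡ m)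
    σ j (suc i) = var (k ↑ʳ i)

  mutual
    -- valT t : formula at level suc n expressing "x₀ is the value of t"
    valT : ∀ {n} → Term L n → Form M (suc n)
    valT (var i) = subF σ eqI
      where
      σ : Sub 2 _
      σ zero          = var zero
      σ (suc zero)    = var (suc i)
    valT {n} (app f ts) =
      ∃ⁿ k (conjArgs (Data.Vec.map (subF ρ) (valTs ts)) ∧' subF σ (funI f))
      where
      k = funAr L f
      -- keep the value variable, make room for the output variable x₀
      ρ : Sub (suc n) (suc (suc n))
      ρ zero    = var zero
      ρ (suc i) = var (suc (suc i))
      σ : Sub (suc k) (k + suc n)
      σ zero    = var (k ↑ʳ zero)
      σ (suc j) = var (j ↑ˡ suc n)

    valTs : ∀ {n k} → Vec (Term L n) k → Vec (Form M (suc n)) k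
    valTs []       = []
    valTs (t ∷ ts) = valT t ∷ valTs ts

  atom : ∀ {n k} → Form M k → Vec (Term L n) k → Form M n
  atom {n} {k} R ts =
    ∃ⁿ k (conjArgs (valTs ts) ∧' subF (λ j → var (j ↑ˡ n)) R)

  tr : ∀ {n} → Form L n → Form M n
  tr ⊥'         = ⊥'
  tr (t ≐ s)    = atom eqI (t ∷ s ∷ [])
  tr (rel r ts) = atom (relI r) ts
  tr (φ ⇒ ψ)    = tr φ ⇒ tr ψ
  tr (∀' φ)     = ∀' (domAt (var zero) ⇒ tr φ)

OneDimInterprets : ∀ {L M} → Theory M → Theory L → Set
OneDimInterprets {L} {M} T U =
  Σ (Translation L M) λ τ → ∀ (φ : Form L 0) → U ⊩ φ → T ⊩ Translate.tr τ φ

LVS : Signature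
LVS = record { Fun = ⊥ ; funAr = λ () ; Rel = ⊤ ; relAr = λ _ → 2 }

_∈'_ : ∀ {n} → Term LVS n → Term LVS n → Form LVS n
x ∈' y = rel tt (x ∷ y ∷ [])

adjAxiom : ℕ → Form LVS 0
adjAxiom n = ∀ᶜ n (∃' (∀' ((var zero ∈' var (suc zero)) ⇔'
                 ⋁ n (λ i → var zero ≐ var (suc (suc i))))))

data VS : Theory LVS where
  vs-empty : VS (∃' (∀' (¬' (var zero ∈' var (suc zero)))))
  vs-adj   : ∀ n → VS (adjAxiom n)

data RFun : Set where
  zeroF succF plusF timesF : RFun

rAr : RFun → ℕ
rAr zeroF  = 0
rAr succF  = 1
rAr plusF  = 2
rAr timesF = 2

LR : Signature
LR = record { Fun = RFun ; funAr = rAr ; Rel = ⊥ ; relAr = λ () }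

𝟎 : ∀ {n} → Term LR n
𝟎 = app zeroF []

𝐒 : ∀ {n} → Term LR n → Term LR n
𝐒 t = app succF (t ∷ [])

_⊕_ : ∀ {n} → Term LR n → Term LR n → Term LR n
t ⊕ s = app plusF (t ∷ s ∷ [])

_⊗_ : ∀ {n} → Term LR n → Term LR n → Term LR n
t ⊗ s = app timesF (t ∷ s ∷ [])

num : ∀ {n} → ℕ → Term LR n
num zero    = 𝟎
num (suc k) = 𝐒 (num k)

_≤'_ : ∀ {n} → Term LR n → Term LR n → Form LR n
x ≤' y = ∃' ((var zero ⊕ wkT x) ≐ wkT y)

data R : Theory LR where
  r-plus  : ∀ m n → R ((num m ⊕ num n) ≐ num (m + n))
  r-times : ∀ m n → R ((num m ⊗ num n) ≐ num (m * n))
  r-neq   : ∀ m n → m ≢ n → R (¬' (num m ≐ num n))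
  r-bound : ∀ n → R (∀' ((var zero ≤' num n) ⇒
                         ⋁ (suc n) (λ k → var zero ≐ num (toℕ k))))
  r-total : ∀ n → R (∀' ((var zero ≤' num n) ∨' (num n ≤' var zero)))

{-# OPTIONS --safe #-}
module Submission where

-- By a constructive form of completeness (Krivine), VS proves every sentence that is true in all structures
-- for VS in which falsum may be an arbitrary type Q and M A = (A → Q) → Q is the classical double negation.
-- So one can argue semantically. Every object counts as a number: x is the successor of y if x = {y}, and
-- a zero if it is not a singleton; the numeral n is then the class of n-fold singletons over a zero. Since
-- VS has all finite sets, it has the graph of every recursion along a numeral, so sums and products of
-- numerals can be read off recursions coded by sets of Kuratowski pairs. About other objects almost nothing
-- can be proved, so equality and the operations are modified to be a total algebra in any case: x ≈ y says
-- that x and y are bisimilar to the same objects, and an operation takes the value of its recursion if this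
-- is unique up to ≈, and a default value otherwise. For every n an object x is either a numeral below n or
-- an n-fold singleton over some z. In the second case x = z + n, provided that successor respects ≈ at x and
-- its iterated predecessors (x is good); for other x the default gives x = x + n. Hence x ≤ n or n ≤ x.

open import Defs
open import Data.Nat
  using (ℕ; zero; suc; _+_; _*_; _∸_; _≤_; _<_; z≤n; s≤s; _⊔_; _≤?_; _≤′_; ≤′-refl; ≤′-step)
open import Data.Nat.Properties
open import Data.Fin using (Fin; zero; suc; toℕ; fromℕ<)
open import Data.Fin.Patterns
open import Data.Fin.Properties using (toℕ-fromℕ<)
open import Data.Vec as Vec using (Vec; []; _∷_; lookup)
open import Data.Vec.Properties using (lookup-map; lookup-++ˡ; lookup-++ʳ)
open import Data.Vec.Relation.Binary.Pointwise.Inductive as Pointwise using (Pointwise; []; _∷_)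
open import Data.List using (List; []; _∷_; map; _++_; upTo; concatMap; cartesianProductWith; allFin)
open import Data.List.Properties using (map-∘; map-cong)
open import Data.List.Membership.Propositional using (_∈_; lose)
open import Data.List.Membership.Propositional.Properties
open import Data.List.Relation.Binary.Subset.Propositional using (_⊆_)
import Data.List.Relation.Binary.Subset.Propositional.Properties as Subset
open import Data.List.Relation.Unary.All as All using (All; []; _∷_)
import Data.List.Relation.Unary.All.Properties as AllP
open import Data.List.Relation.Unary.Any using (here; there)
open import Data.Product using (Σ; _×_; _,_; proj₁; proj₂; ∃; ∃-syntax)
open import Data.Sum using (_⊎_; inj₁; inj₂)
open import Data.Unit using (⊤; tt)
open import Data.Empty using (⊥-elim)
open import Function using (_∘_; id; case_of_)
open import Relation.Nullary using (yes; no)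
open import Relation.Binary.PropositionalEquality hiding ([_])

-- Substitution and weakening of derivations

module _ {L : Signature} where

  mutual
    sub-cong : ∀ {m n} {σ τ : Sub {L} m n} → (∀ i → σ i ≡ τ i) → ∀ t → sub σ t ≡ sub τ t
    sub-cong e (var i)    = e i
    sub-cong e (app f ts) = cong (app f) (subs-cong e ts)

    subs-cong : ∀ {m n k} {σ τ : Sub {L} m n} → (∀ i → σ i ≡ τ i) →
                (ts : Vec (Term L m) k) → subs σ ts ≡ subs τ ts
    subs-cong e []       = refl
    subs-cong e (t ∷ ts) = cong₂ _∷_ (sub-cong e t) (subs-cong e ts)

  mutual
    sub-sub : ∀ {l m n} (τ : Sub {L} m n) (σ : Sub l m) t → sub τ (sub σ t) ≡ sub (sub τ ∘ σ) t
    sub-sub τ σ (var i)    = refl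
    sub-sub τ σ (app f ts) = cong (app f) (subs-subs τ σ ts)

    subs-subs : ∀ {l m n k} (τ : Sub {L} m n) (σ : Sub l m) (ts : Vec (Term L l) k) →
                subs τ (subs σ ts) ≡ subs (sub τ ∘ σ) ts
    subs-subs τ σ []       = refl
    subs-subs τ σ (t ∷ ts) = cong₂ _∷_ (sub-sub τ σ t) (subs-subs τ σ ts)

  mutual
    sub-var : ∀ {n} (t : Term L n) → sub var t ≡ t
    sub-var (var i)    = refl
    sub-var (app f ts) = cong (app f) (subs-var ts)

    subs-var : ∀ {n k} (ts : Vec (Term L n) k) → subs var ts ≡ ts
    subs-var []       = refl
    subs-var (t ∷ ts) = cong₂ _∷_ (sub-var t) (subs-var ts)

  exts-cong : ∀ {m n} {σ τ : Sub {L} m n} → (∀ i → σ i ≡ τ i) → ∀ i → exts σ i ≡ exts τ i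
  exts-cong e zero    = refl
  exts-cong e (suc i) = cong wkT (e i)

  subF-cong : ∀ {m n} {σ τ : Sub {L} m n} → (∀ i → σ i ≡ τ i) → ∀ φ → subF σ φ ≡ subF τ φ
  subF-cong e ⊥'         = refl
  subF-cong e (t ≐ s)    = cong₂ _≐_ (sub-cong e t) (sub-cong e s)
  subF-cong e (rel r ts) = cong (rel r) (subs-cong e ts)
  subF-cong e (φ ⇒ ψ)    = cong₂ _⇒_ (subF-cong e φ) (subF-cong e ψ)
  subF-cong e (∀' φ)     = cong ∀' (subF-cong (exts-cong e) φ)

  sub-exts-wkT : ∀ {m n} (τ : Sub {L} m n) t → sub (exts τ) (wkT t) ≡ wkT (sub τ t)
  sub-exts-wkT τ t = trans (sub-sub (exts τ) _ t) (sym (sub-sub _ τ t))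

  exts-exts : ∀ {l m n} (τ : Sub {L} m n) (σ : Sub l m) i →
              sub (exts τ) (exts σ i) ≡ exts (sub τ ∘ σ) i
  exts-exts τ σ zero    = refl
  exts-exts τ σ (suc i) = sub-exts-wkT τ (σ i)

  subF-subF : ∀ {l m n} (τ : Sub {L} m n) (σ : Sub l m) φ →
              subF τ (subF σ φ) ≡ subF (sub τ ∘ σ) φ
  subF-subF τ σ ⊥'         = refl
  subF-subF τ σ (t ≐ s)    = cong₂ _≐_ (sub-sub τ σ t) (sub-sub τ σ s)
  subF-subF τ σ (rel r ts) = cong (rel r) (subs-subs τ σ ts)
  subF-subF τ σ (φ ⇒ ψ)    = cong₂ _⇒_ (subF-subF τ σ φ) (subF-subF τ σ ψ)
  subF-subF τ σ (∀' φ)     = cong ∀' (trans (subF-subF (exts τ) (exts σ) φ)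
                                            (subF-cong (exts-exts τ σ) φ))

  subF-exts-wk : ∀ {m n} (τ : Sub {L} m n) φ → subF (exts τ) (wk φ) ≡ wk (subF τ φ)
  subF-exts-wk τ φ = trans (subF-subF (exts τ) _ φ) (sym (subF-subF _ τ φ))

  -- The substitution behind φ [ t ] is local to its definition, so τ is described pointwise.
  subF-[] : ∀ {m n} {τ : Sub {L} (suc m) n} (σ : Sub m n) φ t →
            τ zero ≡ t → (∀ i → τ (suc i) ≡ σ i) → subF (exts σ) φ [ t ] ≡ subF τ φ
  subF-[] σ φ t e₀ e = trans (subF-subF _ (exts σ) φ) (subF-cong (λ
    { zero    → sym e₀
    ; (suc i) → trans (sub-sub _ _ (σ i)) (trans (sub-var (σ i)) (sym (e i))) }) φ)

  []-subF : ∀ {m n} (σ : Sub {L} m n) φ t → subF σ (φ [ t ]) ≡ subF (exts σ) φ [ sub σ t ]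
  []-subF σ φ t = trans (subF-subF σ _ φ) (sym (subF-[] σ φ (sub σ t) refl (λ i → refl)))

  map-subF-wk : ∀ {m n} (σ : Sub {L} m n) Γ → map (subF (exts σ)) (map wk Γ) ≡ map wk (map (subF σ) Γ)
  map-subF-wk σ Γ = trans (sym (map-∘ Γ)) (trans (map-cong (subF-exts-wk σ) Γ) (map-∘ Γ))

  ⊢-resp : ∀ {n Γ} {φ ψ : Form L n} → φ ≡ ψ → Γ ⊢ φ → Γ ⊢ ψ
  ⊢-resp refl d = d

  ⊢-subF : ∀ {m n Γ φ} (σ : Sub {L} m n) → Γ ⊢ φ → map (subF σ) Γ ⊢ subF σ φ
  ⊢-subF σ (hyp i)  = hyp (∈-map⁺ _ i)
  ⊢-subF σ (⇒I d)   = ⇒I (⊢-subF σ d)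
  ⊢-subF σ (⇒E d e) = ⇒E (⊢-subF σ d) (⊢-subF σ e)
  ⊢-subF σ (raa d)  = raa (⊢-subF σ d)
  ⊢-subF {Γ = Γ} σ (∀I d) = ∀I (subst (_⊢ _) (map-subF-wk σ Γ) (⊢-subF (exts σ) d))
  ⊢-subF σ (∀E {φ = φ} d t) = ⊢-resp (sym ([]-subF σ φ t)) (∀E (⊢-subF σ d) (sub σ t))
  ⊢-subF σ (refl≐ t) = refl≐ _
  ⊢-subF σ (subst≐ {t = t} {s} φ d e) =
    ⊢-resp (sym ([]-subF σ φ s))
      (subst≐ (subF (exts σ) φ) (⊢-subF σ d) (⊢-resp ([]-subF σ φ t) (⊢-subF σ e)))
  ⊢-subF {Γ = Γ} σ (close {φ = φ} d) =
    close (subst₂ _⊢_ (map-subF-wk σ Γ) (subF-exts-wk σ φ) (⊢-subF (exts σ) d))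

  ⊢-⊆ : ∀ {n Γ Δ} {φ : Form L n} → Γ ⊆ Δ → Γ ⊢ φ → Δ ⊢ φ
  ⊢-⊆ s (hyp i)        = hyp (s i)
  ⊢-⊆ s (⇒I d)         = ⇒I (⊢-⊆ (Subset.∷⁺ʳ _ s) d)
  ⊢-⊆ s (⇒E d e)       = ⇒E (⊢-⊆ s d) (⊢-⊆ s e)
  ⊢-⊆ s (raa d)        = raa (⊢-⊆ (Subset.∷⁺ʳ _ s) d)
  ⊢-⊆ s (∀I d)         = ∀I (⊢-⊆ (Subset.map⁺ wk s) d)
  ⊢-⊆ s (∀E d t)       = ∀E (⊢-⊆ s d) t
  ⊢-⊆ s (refl≐ t)      = refl≐ t
  ⊢-⊆ s (subst≐ φ d e) = subst≐ φ (⊢-⊆ s d) (⊢-⊆ s e)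
  ⊢-⊆ s (close d)      = close (⊢-⊆ (Subset.map⁺ wk s) d)

  ⊥E : ∀ {n Γ} {φ : Form L n} → Γ ⊢ ⊥' → Γ ⊢ φ
  ⊥E d = raa (⊢-⊆ there d)

  -- Drinker's paradox: some x satisfies θ(x) ⇒ ∀y θ(y).
  henkin-elim : ∀ {n Γ} (θ : Form L (suc n)) → (θ ⇒ wk (∀' θ)) ∷ map wk Γ ⊢ ⊥' → Γ ⊢ ⊥'
  henkin-elim {Γ = Γ} θ d = close (⇒E (⇒I d) (⇒I (⊢-⊆ there (⊢-subF _ all))))
    where
    all : Γ ⊢ ∀' θ
    all = ∀I (raa (⇒E (⇒I (⊢-⊆ (Subset.∷⁺ʳ _ there) d)) (⇒I (⊥E (⇒E (hyp (there (here refl))) (hyp (here refl)))))))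

-- Derivability from a class of hypotheses

Der : ∀ {L n} → (Form L n → Set) → Form L n → Set
Der P φ = ∃[ Γ ] All P Γ × (Γ ⊢ φ)

module _ {L : Signature} {n : ℕ} where

  -- Isolates a distinguished hypothesis, whatever its multiplicity, so that it can be discharged
  -- once.
  split-one : ∀ {P : Form L n → Set} {a Γ} → All (λ φ → P φ ⊎ φ ≡ a) Γ →
              ∃[ Δ ] All P Δ × Γ ⊆ a ∷ Δ
  split-one [] = [] , [] , λ ()
  split-one (inj₁ p ∷ ps) with split-one ps
  ... | Δ , qs , s = _ ∷ Δ , p ∷ qs , λ
    { (here refl) → there (here refl)
    ; (there i) → Subset.∷⁺ʳ _ there (s i) }
  split-one (inj₂ refl ∷ ps) with split-one ps
  ... | Δ , qs , s = Δ , qs , λ { (here refl) → here refl ; (there i) → s i }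

  -- The alternative is read off the tags of a finite list, so this choice is constructive.
  all-or-some : ∀ {P Q : Form L n → Set} {Γ} → All (λ φ → P φ ⊎ Q φ) Γ → All P Γ ⊎ ∃ Q
  all-or-some [] = inj₁ []
  all-or-some (inj₂ q ∷ _) = inj₂ (_ , q)
  all-or-some (inj₁ p ∷ ps) with all-or-some ps
  ... | inj₁ qs = inj₁ (p ∷ qs)
  ... | inj₂ x  = inj₂ x

  Der-⇒E : ∀ {P : Form L n → Set} {φ ψ} → Der P (φ ⇒ ψ) → Der P φ → Der P ψ
  Der-⇒E (Γ , ps , d) (Δ , qs , e) =
    Γ ++ Δ , AllP.++⁺ ps qs , ⇒E (⊢-⊆ (Subset.xs⊆xs++ys Γ Δ) d) (⊢-⊆ (Subset.xs⊆ys++xs Δ Γ) e)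

  Der-map : ∀ {P : Form L n → Set} {φ ψ} → (∀ {Γ} → Γ ⊢ φ → Γ ⊢ ψ) → Der P φ → Der P ψ
  Der-map f (Γ , ps , d) = Γ , ps , f d

all-map-wk : ∀ {L n} {P : Form L n → Set} {Γ} →
             All (λ φ → ∃[ ψ ] P ψ × φ ≡ wk ψ) Γ → ∃[ Δ ] All P Δ × Γ ≡ map wk Δ
all-map-wk [] = [] , [] , refl
all-map-wk ((ψ , p , refl) ∷ xs) with all-map-wk xs
... | Δ , qs , refl = ψ ∷ Δ , p ∷ qs , refl

-- Completeness for structures with an arbitrary falsum

module Enumeration {X : Set} (default : X) (xs : ℕ → List X) where

  -- The number of the current block, and the part of that block still to be listed.
  State : Set
  State = ℕ × List X

  next : State → State
  next (d , [])     = suc d , xs (suc d)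
  next (d , _ ∷ ys) = d , ys

  state : ℕ → State
  state zero    = 0 , xs 0
  state (suc n) = next (state n)

  head : State → X
  head (d , [])    = default
  head (d , x ∷ _) = x

  enum : ℕ → X
  enum n = head (state n)

  drain : ∀ n {d ys} → state n ≡ (d , ys) → ∃[ m ] n < m × state m ≡ (suc d , xs (suc d))
  drain n {ys = []}    e = suc n , ≤-refl , cong next e
  drain n {ys = _ ∷ _} e with drain (suc n) (cong next e)
  ... | m , n<m , e′ = m , <-trans ≤-refl n<m , e′

  refill : ∀ d → ∃[ n ] d ≤ n × state n ≡ (d , xs d)
  refill zero = 0 , z≤n , refl
  refill (suc d) with refill d
  ... | n , d≤n , e with drain n e
  ... | m , n<m , e′ = m , ≤-<-trans d≤n n<m , e′

  reach : ∀ n {d ys x} → state n ≡ (d , ys) → x ∈ ys → ∃[ m ] n ≤ m × enum m ≡ x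
  reach n e (here refl) = n , ≤-refl , cong head e
  reach n e (there i) with reach (suc n) (cong next e) i
  ... | m , n≤m , e′ = m , ≤-trans (n≤1+n n) n≤m , e′

  -- Block `d ⊔ N` contains `x` and begins no earlier than stage `d ⊔ N`. Recurrence lets a formula
  -- be treated after all its parameters have been introduced.
  enum-often : ∀ N {d x} → (∀ n → d ≤ n → x ∈ xs n) → ∃[ n ] N ≤ n × enum n ≡ x
  enum-often N {d} p with refill (d ⊔ N)
  ... | m , le , e with reach m e (p _ (m≤m⊔n d N))
  ... | n , m≤n , e′ = n , ≤-trans (m≤n⊔m d N) (≤-trans le m≤n) , e′

-- Enumeration of the formulas with parameters

forms : ∀ k → ℕ → List (Form LVS k)
forms k zero    = []
forms k (suc d) =
  ⊥' ∷ cartesianProductWith (λ i j → var i ≐ var j) (allFin k) (allFin k)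
  ++ cartesianProductWith (λ i j → var i ∈' var j) (allFin k) (allFin k)
  ++ cartesianProductWith _⇒_ (forms k d) (forms k d)
  ++ map ∀' (forms (suc k) d)

depth : ∀ {k} → Form LVS k → ℕ
depth ⊥'        = 1
depth (t ≐ s)   = 1
depth (rel r _) = 1
depth (φ ⇒ ψ)   = suc (depth φ ⊔ depth ψ)
depth (∀' φ)    = suc (depth φ)

∈-forms : ∀ {k} (φ : Form LVS k) d → depth φ ≤ d → φ ∈ forms k d
∈-forms ⊥' (suc d) le = here refl
∈-forms (var i ≐ var j) (suc d) le =
  there (∈-++⁺ˡ (∈-cartesianProductWith⁺ _ (∈-allFin i) (∈-allFin j)))
∈-forms {k} (rel tt (var i ∷ var j ∷ [])) (suc d) le =
  there (∈-++⁺ʳ (cartesianProductWith _ (allFin k) (allFin k))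
    (∈-++⁺ˡ (∈-cartesianProductWith⁺ _ (∈-allFin i) (∈-allFin j))))
∈-forms {k} (φ ⇒ ψ) (suc d) (s≤s le) =
  there (∈-++⁺ʳ (cartesianProductWith _ (allFin k) (allFin k))
    (∈-++⁺ʳ (cartesianProductWith _ (allFin k) (allFin k))
      (∈-++⁺ˡ (∈-cartesianProductWith⁺ _⇒_
        (∈-forms φ d (≤-trans (m≤m⊔n _ (depth ψ)) le))
        (∈-forms ψ d (≤-trans (m≤n⊔m (depth φ) _) le))))))
∈-forms {k} (∀' φ) (suc d) (s≤s le) =
  there (∈-++⁺ʳ (cartesianProductWith _ (allFin k) (allFin k))
    (∈-++⁺ʳ (cartesianProductWith _ (allFin k) (allFin k))
      (∈-++⁺ʳ (cartesianProductWith _⇒_ (forms k d) (forms k d))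
        (∈-map⁺ ∀' (∈-forms φ d le)))))

vecs : ∀ k → ℕ → List (Vec ℕ k)
vecs zero    d = [] ∷ []
vecs (suc k) d = cartesianProductWith _∷_ (upTo d) (vecs k d)

bound : ∀ {k} → Vec ℕ k → ℕ
bound []      = 0
bound (a ∷ ρ) = suc a ⊔ bound ρ

∈-vecs : ∀ {k} (ρ : Vec ℕ k) d → bound ρ ≤ d → ρ ∈ vecs k d
∈-vecs []      d le = here refl
∈-vecs (a ∷ ρ) d le = ∈-cartesianProductWith⁺ _∷_
  (∈-upTo⁺ (≤-trans (m≤m⊔n (suc a) (bound ρ)) le)) (∈-vecs ρ d (≤-trans (m≤n⊔m (suc a) _) le))

lookup<bound : ∀ {k} (ρ : Vec ℕ k) i → lookup ρ i < bound ρ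
lookup<bound (a ∷ ρ) zero    = m≤m⊔n (suc a) (bound ρ)
lookup<bound (a ∷ ρ) (suc i) = ≤-trans (lookup<bound ρ i) (m≤n⊔m (suc a) _)

-- A formula with variable 0 left open and levels as parameters for its other variables.
Closure : Set
Closure = ∃[ k ] Form LVS (suc k) × Vec ℕ k

closures : ℕ → List Closure
closures d = concatMap (λ k → cartesianProductWith (λ φ ρ → k , φ , ρ) (forms (suc k) d) (vecs k d)) (upTo d)

∈-closures : ∀ {k} (φ : Form LVS (suc k)) (ρ : Vec ℕ k) d →
             suc k ⊔ (depth φ ⊔ bound ρ) ≤ d → (k , φ , ρ) ∈ closures d
∈-closures {k} φ ρ d le = ∈-concatMap⁺ _ (lose (∈-upTo⁺ (≤-trans (m≤m⊔n (suc k) (depth φ ⊔ bound ρ)) le))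
  (∈-cartesianProductWith⁺ _ (∈-forms φ d (≤-trans (m≤m⊔n _ (bound ρ)) le′))
                             (∈-vecs ρ d (≤-trans (m≤n⊔m (depth φ) _) le′))))
  where le′ = ≤-trans (m≤n⊔m (suc k) _) le

open Enumeration {Closure} (0 , ⊥' , []) closures using (enum; enum-often)

-- Level l is the variable introduced at stage l, so its de Bruijn index at stage n is n − l;
-- levels that do not exist yet are sent to zero.
ix : ∀ n → ℕ → Fin (suc n)
ix zero    l = zero
ix (suc n) l with l ≤? n
... | yes _ = suc (ix n l)
... | no  _ = zero

ix-suc : ∀ {n l} → l ≤ n → ix (suc n) l ≡ suc (ix n l)
ix-suc {n} {l} le with l ≤? n
... | yes _  = refl
... | no  ¬p = ⊥-elim (¬p le)

ix-new : ∀ n → ix (suc n) (suc n) ≡ zero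
ix-new n with suc n ≤? n
... | yes p = ⊥-elim (1+n≰n p)
... | no  _ = refl

at : ∀ n {k} → Vec ℕ k → Sub {LVS} k (suc n)
at n ρ i = var (ix n (lookup ρ i))

inst : ∀ n {k} → Form LVS k → Vec ℕ k → Form LVS (suc n)
inst n φ ρ = subF (at n ρ) φ

-- The bound says that all parameters are existing levels, whose indices just shift by one when a
-- variable is added.
inst-suc : ∀ {n k} (φ : Form LVS k) (ρ : Vec ℕ k) → bound ρ ≤ suc n → wk (inst n φ ρ) ≡ inst (suc n) φ ρ
inst-suc φ ρ le = trans (subF-subF _ _ φ) (subF-cong
  (λ i → cong var (sym (ix-suc (≤-pred (≤-trans (lookup<bound ρ i) le))))) φ)

inst-wk : ∀ n {k} (φ : Form LVS k) a ρ → inst n (wk φ) (a ∷ ρ) ≡ inst n φ ρ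
inst-wk n φ a ρ = subF-subF _ _ φ

body : ∀ n {k} → Form LVS (suc k) → Vec ℕ k → Form LVS (suc (suc n))
body n φ ρ = subF (exts (at n ρ)) φ

body-suc : ∀ n {k} (φ : Form LVS (suc k)) (ρ : Vec ℕ k) → bound ρ ≤ suc n →
           body n φ ρ ≡ inst (suc n) φ (suc n ∷ ρ)
body-suc n φ ρ le = subF-cong (λ
  { zero    → cong var (sym (ix-new n))
  ; (suc i) → cong var (sym (ix-suc (≤-pred (≤-trans (lookup<bound ρ i) le)))) }) φ

-- The open place is filled by the new variable. The same formula is the premise of a Henkin axiom
-- and the candidate for completion.
task : ∀ n → Form LVS (suc (suc n))
task n = let (_ , φ , ρ) = enum n in body n φ ρ

task-often : ∀ {k} (φ : Form LVS (suc k)) (ρ : Vec ℕ k) N →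
             ∃[ n ] N ≤ n × task n ≡ body n φ ρ
task-often φ ρ N with enum-often N (∈-closures φ ρ)
... | n , le , e = n , le , cong (λ { (_ , ψ , σ) → body n ψ σ }) e

-- Classical structures

module Classical (Q : Set) where

  M : Set → Set
  M A = (A → Q) → Q

  return : ∀ {A} → A → M A
  return a k = k a

  _>>=_ : ∀ {A B} → M A → (A → M B) → M B
  (m >>= f) k = m λ a → f a k

  absurd : ∀ {A} → Q → M A
  absurd q _ = q

  excluded-middle : ∀ A → M (A ⊎ (A → Q))
  excluded-middle A k = k (inj₂ λ a → k (inj₁ a))

-- Falsum is an arbitrary type Q, so no consistency is needed to build such a structure.
record Structure : Set₁ where
  field
    Q D    : Set
    E EQ   : D → D → Set
    point  : D

  open Classical Q public

  field
    E-stable  : ∀ {x y} → M (E x y) → E x y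
    EQ-stable : ∀ {x y} → M (EQ x y) → EQ x y
    EQ-refl   : ∀ {x} → EQ x x
    EQ-sym    : ∀ {x y} → EQ x y → EQ y x
    EQ-trans  : ∀ {x y z} → EQ x y → EQ y z → EQ x z
    E-resp    : ∀ {x x′ y y′} → EQ x x′ → EQ y y′ → E x y → E x′ y′

  val : ∀ {n} → Term LVS n → Vec D n → D
  val (var i) ρ = lookup ρ i

  ⟦_⟧ : ∀ {n} → Form LVS n → Vec D n → Set
  ⟦ ⊥' ⟧ ρ                  = Q
  ⟦ t ≐ s ⟧ ρ               = EQ (val t ρ) (val s ρ)
  ⟦ rel r (t ∷ s ∷ []) ⟧ ρ  = E (val t ρ) (val s ρ)
  ⟦ φ ⇒ ψ ⟧ ρ               = ⟦ φ ⟧ ρ → ⟦ ψ ⟧ ρ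
  ⟦ ∀' φ ⟧ ρ                = ∀ x → ⟦ φ ⟧ (x ∷ ρ)

-- The Henkin construction

module Completeness (T : Theory LVS) (φ₀ : Form LVS 0) where

  Q : Set
  Q = T ⊩ φ₀

  mutual
    𝕋 : ∀ n → Form LVS (suc n) → Set
    𝕋 zero    φ = (∃[ ψ ] T ψ × φ ≡ wk ψ) ⊎ φ ≡ wk (¬' φ₀)
    𝕋 (suc n) φ = 𝕌 n φ ⊎ (φ ≡ task n × Compatible n)

    𝕌 : ∀ n → Form LVS (suc (suc n)) → Set
    𝕌 n φ = (∃[ ψ ] 𝕋 n ψ × φ ≡ wk ψ) ⊎ φ ≡ task n ⇒ wk (∀' (task n))

    -- Consistency relative to Q; it need not be decided, since it only guards membership in 𝕋 (suc n).
    Compatible : ℕ → Set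
    Compatible n = ∀ {Γ} → All (𝕌 n) Γ → task n ∷ Γ ⊢ ⊥' → Q

  -- A refutation is pushed down to stage 0, where it becomes a proof of `φ₀`. Henkin axioms are
  -- eliminated; a task among the hypotheses carries the proof of compatibility that gives `Q`
  -- directly.
  consistent : ∀ n → Der (𝕋 n) ⊥' → Q
  consistent-𝕌 : ∀ n → Der (𝕌 n) ⊥' → Q

  consistent zero (Γ , ps , d) with split-one ps
  ... | Δ , qs , s with all-map-wk qs
  ... | Δ′ , ts , refl = Δ′ , ts , close (raa (⊢-⊆ s d))
  consistent (suc n) (Γ , ps , d) with all-or-some ps
  ... | inj₁ us = consistent-𝕌 n (Γ , us , d)
  ... | inj₂ (_ , _ , c) with split-one (All.map (λ { (inj₁ u) → inj₁ u ; (inj₂ (e , _)) → inj₂ e }) ps)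
  ... | Δ , us , s = c us (⊢-⊆ s d)

  consistent-𝕌 n (Γ , us , d) with split-one us
  ... | Δ , qs , s with all-map-wk qs
  ... | Δ′ , ts , refl = consistent n (Δ′ , ts , henkin-elim (task n) (⊢-⊆ s d))

  lift₁ : ∀ {n φ} → Der (𝕋 n) φ → Der (𝕋 (suc n)) (wk φ)
  lift₁ (Γ , ps , d) = map wk Γ , AllP.gmap⁺ (λ p → inj₁ (inj₁ (_ , p , refl))) ps , ⊢-subF _ d

  lift : ∀ {n m k} (φ : Form LVS k) ρ → bound ρ ≤ suc n → n ≤′ m →
         Der (𝕋 n) (inst n φ ρ) → Der (𝕋 m) (inst m φ ρ)
  lift φ ρ le ≤′-refl d = d
  lift φ ρ le (≤′-step n≤m) d = subst (Der _) (inst-suc φ ρ (≤-trans le (s≤s (≤′⇒≤ n≤m))))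
    (lift₁ (lift φ ρ le n≤m d))

  -- Only late stages count, because at early ones some parameters may not exist yet.
  record Holds {k} (φ : Form LVS k) (ρ : Vec ℕ k) : Set where
    constructor eventually
    field
      from : ℕ
      derivable : ∀ n → from ≤ n → Der (𝕋 n) (inst n φ ρ)

  holds : ∀ {n k} (φ : Form LVS k) ρ → bound ρ ≤ suc n → Der (𝕋 n) (inst n φ ρ) → Holds φ ρ
  holds {n} φ ρ le d = eventually n λ m n≤m → lift φ ρ le (≤⇒≤′ n≤m) d

  Holds-map : ∀ {k l} {φ : Form LVS k} {ρ} {ψ : Form LVS l} {σ} →
              (∀ {n Γ} → Γ ⊢ inst n φ ρ → Γ ⊢ inst n ψ σ) → Holds φ ρ → Holds ψ σ
  Holds-map f (eventually N p) = eventually N λ n le → Der-map f (p n le)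

  Holds-⇒E : ∀ {k} {φ ψ : Form LVS k} {ρ} → Holds (φ ⇒ ψ) ρ → Holds φ ρ → Holds ψ ρ
  Holds-⇒E (eventually N p) (eventually N′ q) = eventually (N ⊔ N′) λ n le →
    Der-⇒E (p n (≤-trans (m≤m⊔n N N′) le)) (q n (≤-trans (m≤n⊔m N N′) le))

  Holds-⊥ : ∀ {k} {ρ : Vec ℕ k} → Holds ⊥' ρ → Q
  Holds-⊥ (eventually N p) = consistent N (p N ≤-refl)

  -- When the turn of `φ` comes, a derivation of falsum from it would give `Holds (¬' φ)` and so
  -- `Q`. Hence `φ` is compatible and has been added, with nothing decided.
  lindenbaum : ∀ {k} {φ : Form LVS k} {ρ} → (Holds (¬' φ) ρ → Q) → Holds φ ρ
  -- Weakening makes `φ` a task whose open place is a dummy.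
  lindenbaum {φ = φ} {ρ} h with task-often (wk φ) ρ (bound ρ)
  ... | n , le , e = holds φ ρ le″ (task n ∷ [] , inj₂ (refl , compatible) ∷ [] , ⊢-resp eq (hyp (here refl)))
    where
    le′ = ≤-trans le (n≤1+n n)
    le″ = ≤-trans le′ (n≤1+n _)
    eq : task n ≡ inst (suc n) φ ρ
    eq = trans e (trans (body-suc n (wk φ) ρ le′) (inst-wk (suc n) φ _ ρ))
    compatible : Compatible n
    compatible us d = h (holds (¬' φ) ρ le″
      (_ , All.map inj₁ us , ⇒I (subst (λ χ → χ ∷ _ ⊢ ⊥') eq d)))

  Holds-stable : ∀ {k} {φ : Form LVS k} {ρ} → ((Holds φ ρ → Q) → Q) → Holds φ ρ
  Holds-stable m = lindenbaum λ n → m λ h → Holds-⊥ (Holds-⇒E n h)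

  Holds-⇒I : ∀ {k} {φ ψ : Form LVS k} {ρ} → (Holds φ ρ → Holds ψ ρ) → Holds (φ ⇒ ψ) ρ
  Holds-⇒I f = lindenbaum λ n → Holds-⊥ (Holds-⇒E
    (Holds-map (λ d → ⇒I (⇒E (⊢-⊆ there d) (⇒I (hyp (there (here refl)))))) n)
    (f (Holds-map (λ d → raa (⇒E (⊢-⊆ there d)
      (⇒I (⊥E (⇒E (hyp (there (here refl))) (hyp (here refl))))))) n)))

  Holds-∀E : ∀ {k} {φ : Form LVS (suc k)} {ρ} → Holds (∀' φ) ρ → ∀ a → Holds φ (a ∷ ρ)
  Holds-∀E {φ = φ} {ρ} h a = Holds-map (λ {n} d →
    ⊢-resp (subF-[] (at n ρ) φ (var (ix n a)) refl (λ i → refl)) (∀E d (var (ix n a)))) h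

  -- The level `suc n`, introduced when `φ` is treated, is its Henkin constant: the instance there
  -- implies the universal formula.
  Holds-∀I : ∀ {k} {φ : Form LVS (suc k)} {ρ} → (∀ a → Holds φ (a ∷ ρ)) → Holds (∀' φ) ρ
  Holds-∀I {φ = φ} {ρ} h with task-often φ ρ (bound ρ)
  ... | n , le , e = Holds-map (⊢-resp (inst-wk _ (∀' φ) (suc n) ρ)) (Holds-⇒E henkin (h (suc n)))
    where
    le′ = ≤-trans le (n≤1+n n)
    eq : (task n ⇒ wk (∀' (task n))) ≡ inst (suc n) (φ ⇒ wk (∀' φ)) (suc n ∷ ρ)
    eq = cong₂ _⇒_ (trans e (body-suc n φ ρ le′))
      (trans (cong (wk ∘ ∀') e) (trans (inst-suc (∀' φ) ρ le′) (sym (inst-wk _ (∀' φ) _ ρ))))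
    henkin : Holds (φ ⇒ wk (∀' φ)) (suc n ∷ ρ)
    henkin = holds (φ ⇒ wk (∀' φ)) (suc n ∷ ρ) (⊔-lub ≤-refl (≤-trans le′ (n≤1+n _)))
      (_ , inj₁ (inj₂ refl) ∷ [] , ⊢-resp eq (hyp (here refl)))

  Holds-subst : ∀ {k} (φ : Form LVS (suc k)) {ρ x y} → Holds (var zero ≐ var (suc zero)) (x ∷ y ∷ []) →
                Holds φ (x ∷ ρ) → Holds φ (y ∷ ρ)
  Holds-subst φ {ρ} {x} {y} (eventually N p) (eventually N′ q) = eventually (N ⊔ N′) λ n le →
    Der-⇒E (Der-map (λ {Γ} d → ⇒I (⊢-resp (inst-body n y)
                      (subst≐ (body n φ ρ) (⊢-⊆ there d)
                        (⊢-resp (sym (inst-body n x)) (hyp (here refl))))))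
                    (p n (≤-trans (m≤m⊔n N N′) le)))
           (q n (≤-trans (m≤n⊔m N N′) le))
    where
    inst-body : ∀ n a → body n φ ρ [ var (ix n a) ] ≡ inst n φ (a ∷ ρ)
    inst-body n a = subF-[] (at n ρ) φ (var (ix n a)) refl (λ i → refl)

  model : Structure
  model = record
    { Q = Q ; D = ℕ
    ; E  = λ x y → Holds (v₀ ∈' v₁) (x ∷ y ∷ [])
    ; EQ = λ x y → Holds (v₀ ≐ v₁) (x ∷ y ∷ [])
    ; point = 0
    ; E-stable  = Holds-stable
    ; EQ-stable = Holds-stable
    ; EQ-refl   = EQ-refl
    ; EQ-sym    = λ {x} h → Holds-subst (v₀ ≐ v₁) {x ∷ []} h EQ-refl
    ; EQ-trans  = λ {x} h k → Holds-map id (Holds-subst (v₁ ≐ v₀) {x ∷ []} k (Holds-map id h))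
    ; E-resp    = λ {x} {x′} {y} {y′} h k e →
        Holds-map id (Holds-subst (v₁ ∈' v₀) {x′ ∷ []} k (Holds-map id (Holds-subst (v₀ ∈' v₁) {y ∷ []} h e)))
    }
    where
    v₀ v₁ : Term LVS 2
    v₀ = var zero
    v₁ = var (suc zero)
    EQ-refl : ∀ {x} → Holds (v₀ ≐ v₁) (x ∷ x ∷ [])
    EQ-refl = eventually 0 λ n _ → [] , [] , refl≐ _

  open Structure model using (⟦_⟧)

  truth : ∀ {k} (φ : Form LVS k) ρ → (⟦ φ ⟧ ρ → Holds φ ρ) × (Holds φ ρ → ⟦ φ ⟧ ρ)
  truth ⊥' ρ = (λ q → lindenbaum (λ _ → q)) , Holds-⊥
  truth (var i ≐ var j) ρ = Holds-map id , Holds-map id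
  truth (rel tt (var i ∷ var j ∷ [])) ρ = Holds-map id , Holds-map id
  truth (φ ⇒ ψ) ρ =
    (λ f → Holds-⇒I (proj₁ (truth ψ ρ) ∘ f ∘ proj₂ (truth φ ρ))) ,
    (λ h x → proj₂ (truth ψ ρ) (Holds-⇒E h (proj₁ (truth φ ρ) x)))
  truth (∀' φ) ρ =
    (λ f → Holds-∀I (λ a → proj₁ (truth φ (a ∷ ρ)) (f a))) ,
    (λ h a → proj₂ (truth φ (a ∷ ρ)) (Holds-∀E h a))

  at-start : ∀ {φ : Form LVS 0} → 𝕋 0 (wk φ) → Holds φ []
  at-start {φ} p = holds {0} φ [] z≤n (_ , p ∷ [] , ⊢-resp (subF-cong (λ ()) φ) (hyp (here refl)))

  -- The model satisfies `T` and the negation of `φ₀`. If `φ₀` is true as well, so is the falsum of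
  -- the model, and that is a proof of `φ₀`.
  completeness : ((∀ ψ → T ψ → ⟦ ψ ⟧ []) → ⟦ φ₀ ⟧ []) → T ⊩ φ₀
  completeness h = Holds-⊥ (Holds-⇒E
    (at-start {¬' φ₀} (inj₂ refl))
    (proj₁ (truth φ₀ []) (h (λ ψ t → proj₂ (truth ψ []) (at-start (inj₁ (ψ , t , refl)))))))

-- Soundness of relational interpretations in classical structures

-- Unlike those of Form, the connectives of Fm have a direct meaning ⟪_⟫ in which M occurs only at or and ex.
data Fm : ℕ → Set where
  mem eq          : ∀ {n} → Fin n → Fin n → Fm n
  true            : ∀ {n} → Fm n
  _and_ _or_ _imp_ : ∀ {n} → Fm n → Fm n → Fm n
  not             : ∀ {n} → Fm n → Fm n
  ex all          : ∀ {n} → Fm (suc n) → Fm n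
  call            : ∀ {k n} → Fm k → Vec (Fin n) k → Fm n

⌜_⌝ : ∀ {n} → Fm n → Form LVS n
⌜ mem i j ⌝   = var i ∈' var j
⌜ eq i j ⌝    = var i ≐ var j
⌜ true ⌝      = ⊤'
⌜ φ and ψ ⌝   = ⌜ φ ⌝ ∧' ⌜ ψ ⌝
⌜ φ or ψ ⌝    = ⌜ φ ⌝ ∨' ⌜ ψ ⌝
⌜ φ imp ψ ⌝   = ⌜ φ ⌝ ⇒ ⌜ ψ ⌝
⌜ not φ ⌝     = ¬' ⌜ φ ⌝
⌜ ex φ ⌝      = ∃' ⌜ φ ⌝
⌜ all φ ⌝     = ∀' ⌜ φ ⌝
⌜ call φ vs ⌝ = subF (λ i → var (lookup vs i)) ⌜ φ ⌝

infix 1 _⟺_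
_⟺_ : Set → Set → Set
A ⟺ B = (A → B) × (B → A)

⟺-trans : ∀ {A B C} → A ⟺ B → B ⟺ C → A ⟺ C
⟺-trans (f , f′) (g , g′) = g ∘ f , f′ ∘ g′

×-⟺ : ∀ {A A′ B B′} → A ⟺ A′ → B ⟺ B′ → (A × B) ⟺ (A′ × B′)
×-⟺ (f , f′) (g , g′) = (λ (a , b) → f a , g b) , (λ (a , b) → f′ a , g′ b)

Π-⟺ : ∀ {X : Set} {A B : X → Set} → (∀ x → A x ⟺ B x) → (∀ x → A x) ⟺ (∀ x → B x)
Π-⟺ h = (λ f x → proj₁ (h x) (f x)) , (λ f x → proj₂ (h x) (f x))

module Semantics (𝓢 : Structure) where
  open Structure 𝓢 public

  M-⟺ : ∀ {A B} → A ⟺ B → M A ⟺ M B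
  M-⟺ (f , g) = (λ m k → m (k ∘ f)) , (λ m k → m (k ∘ g))

  ∃-⟺ : ∀ {X : Set} {A B : X → Set} → (∀ x → A x ⟺ B x) → M (∃ A) ⟺ M (∃ B)
  ∃-⟺ h = M-⟺ ((λ (x , a) → x , proj₁ (h x) a) , (λ (x , b) → x , proj₂ (h x) b))

  -- All primitives are negative: falsum and atoms are stable, and `⇒` and `∀'` preserve stability.
  ⟦⟧-stable : ∀ {n} (φ : Form LVS n) {ρ} → M (⟦ φ ⟧ ρ) → ⟦ φ ⟧ ρ
  ⟦⟧-stable ⊥'                      m = m id
  ⟦⟧-stable (var i ≐ var j)         m = EQ-stable m
  ⟦⟧-stable (rel tt (t ∷ s ∷ []))   m = E-stable m
  ⟦⟧-stable (φ ⇒ ψ)                 m a = ⟦⟧-stable ψ λ k → m λ f → k (f a)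
  ⟦⟧-stable (∀' φ)                  m x = ⟦⟧-stable φ λ k → m λ f → k (f x)

  val-sub : ∀ {m n} {σ : Sub m n} {ρ : Vec D n} {ρ′ : Vec D m} →
            (∀ i → val (σ i) ρ ≡ lookup ρ′ i) → ∀ t → val (sub σ t) ρ ≡ val t ρ′
  val-sub e (var i) = e i

  val-exts : ∀ {m n} {σ : Sub m n} {ρ : Vec D n} {ρ′ : Vec D m} →
             (∀ i → val (σ i) ρ ≡ lookup ρ′ i) →
             ∀ x i → val (exts σ i) (x ∷ ρ) ≡ lookup (x ∷ ρ′) i
  val-exts e x zero = refl
  val-exts {σ = σ} {ρ} e x (suc i) = trans (val-sub {ρ′ = ρ} (λ _ → refl) (σ i)) (e i)

  ≡-⟺ : ∀ {A B} → A ≡ B → A ⟺ B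
  ≡-⟺ refl = id , id

  ⟦⟧-sub : ∀ {m n} (φ : Form LVS m) {σ : Sub m n} (ρ : Vec D n) (ρ′ : Vec D m) →
           (∀ i → val (σ i) ρ ≡ lookup ρ′ i) → ⟦ subF σ φ ⟧ ρ ⟺ ⟦ φ ⟧ ρ′
  ⟦⟧-sub ⊥' ρ ρ′ e = id , id
  ⟦⟧-sub (t ≐ s) ρ ρ′ e = ≡-⟺ (cong₂ EQ (val-sub e t) (val-sub e s))
  ⟦⟧-sub (rel r (t ∷ s ∷ [])) ρ ρ′ e = ≡-⟺ (cong₂ E (val-sub e t) (val-sub e s))
  ⟦⟧-sub (φ ⇒ ψ) ρ ρ′ e = (λ f → proj₁ ψ≈ ∘ f ∘ proj₂ φ≈) , (λ f → proj₂ ψ≈ ∘ f ∘ proj₁ φ≈)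
    where
    φ≈ = ⟦⟧-sub φ ρ ρ′ e
    ψ≈ = ⟦⟧-sub ψ ρ ρ′ e
  ⟦⟧-sub (∀' φ) {σ} ρ ρ′ e = Π-⟺ λ x → ⟦⟧-sub φ (x ∷ ρ) (x ∷ ρ′) (val-exts {σ = σ} e x)

  ∧-sem : ∀ {n} (φ ψ : Form LVS n) {ρ} → ⟦ φ ∧' ψ ⟧ ρ ⟺ (⟦ φ ⟧ ρ × ⟦ ψ ⟧ ρ)
  ∧-sem φ ψ =
    (λ c → ⟦⟧-stable φ (λ k → c λ a _ → k a) , ⟦⟧-stable ψ (λ k → c λ _ b → k b)) ,
    (λ (a , b) k → k a b)

  ∨-sem : ∀ {n} (φ ψ : Form LVS n) {ρ} → ⟦ φ ∨' ψ ⟧ ρ ⟺ M (⟦ φ ⟧ ρ ⊎ ⟦ ψ ⟧ ρ)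
  ∨-sem φ ψ =
    (λ d k → k (inj₂ (d λ a → k (inj₁ a)))) ,
    (λ m n → ⟦⟧-stable ψ λ k → m λ { (inj₁ a) → n a ; (inj₂ b) → k b })

  ∃-sem : ∀ {n} (φ : Form LVS (suc n)) {ρ} → ⟦ ∃' φ ⟧ ρ ⟺ M (∃[ x ] ⟦ φ ⟧ (x ∷ ρ))
  ∃-sem φ = (λ m k → m λ x a → k (x , a)) , (λ m k → m λ (x , a) → k x a)

  ⋀-sem : ∀ {n} k (φ : Fin k → Form LVS n) {ρ} → ⟦ ⋀ k φ ⟧ ρ ⟺ (∀ i → ⟦ φ i ⟧ ρ)
  ⋀-sem zero    φ = (λ _ ()) , (λ _ → id)
  ⋀-sem (suc k) φ = ⟺-trans (∧-sem (φ zero) (⋀ k (φ ∘ suc))) (⟺-trans (×-⟺ (id , id) (⋀-sem k (φ ∘ suc)))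
    ((λ (a , f) → λ { zero → a ; (suc i) → f i }) , (λ f → f zero , f ∘ suc)))

  ⋁-sem : ∀ {n} k (φ : Fin k → Form LVS n) {ρ} → ⟦ ⋁ k φ ⟧ ρ ⟺ M (∃[ i ] ⟦ φ i ⟧ ρ)
  ⋁-sem zero    φ = (λ q _ → q) , (λ m → m λ ())
  ⋁-sem (suc k) φ = ⟺-trans (∨-sem (φ zero) (⋁ k (φ ∘ suc)))
    ((λ m → m >>= λ { (inj₁ a) → return (zero , a)
                    ; (inj₂ b) → proj₁ (⋁-sem k (φ ∘ suc)) b >>= λ (i , c) → return (suc i , c) }) ,
     (λ m → m >>= λ { (zero , a) → return (inj₁ a)
                    ; (suc i , c) → return (inj₂ (proj₂ (⋁-sem k (φ ∘ suc)) (return (i , c)))) }))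

  ∃ⁿ-sem : ∀ k {m} (φ : Form LVS (k + m)) {ρ} → ⟦ ∃ⁿ k φ ⟧ ρ ⟺ M (∃[ ys ] ⟦ φ ⟧ (ys Vec.++ ρ))
  ∃ⁿ-sem zero    φ = (λ a → return ([] , a)) , (λ m → ⟦⟧-stable φ λ k → m λ { ([] , a) → k a })
  ∃ⁿ-sem (suc k) φ = ⟺-trans (∃ⁿ-sem k (∃' φ))
    ((λ m → m >>= λ (ys , c) → proj₁ (∃-sem φ) c >>= λ (y , a) → return (y ∷ ys , a)) ,
     (λ m → m >>= λ { (y ∷ ys , a) → return (ys , proj₂ (∃-sem φ) (return (y , a))) }))

  ∀ᶜ-sem : ∀ k (φ : Form LVS k) → ⟦ ∀ᶜ k φ ⟧ [] → ∀ ρ → ⟦ φ ⟧ ρ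
  ∀ᶜ-sem zero    φ h []      = h
  ∀ᶜ-sem (suc k) φ h (x ∷ ρ) = ∀ᶜ-sem k (∀' φ) h ρ x

  ⟪_⟫ : ∀ {n} → Fm n → Vec D n → Set
  ⟪ mem i j ⟫ ρ   = E (lookup ρ i) (lookup ρ j)
  ⟪ eq i j ⟫ ρ    = EQ (lookup ρ i) (lookup ρ j)
  ⟪ true ⟫ ρ      = ⊤
  ⟪ φ and ψ ⟫ ρ   = ⟪ φ ⟫ ρ × ⟪ ψ ⟫ ρ
  ⟪ φ or ψ ⟫ ρ    = M (⟪ φ ⟫ ρ ⊎ ⟪ ψ ⟫ ρ)
  ⟪ φ imp ψ ⟫ ρ   = ⟪ φ ⟫ ρ → ⟪ ψ ⟫ ρ
  ⟪ not φ ⟫ ρ     = ⟪ φ ⟫ ρ → Q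
  ⟪ ex φ ⟫ ρ      = M (∃[ x ] ⟪ φ ⟫ (x ∷ ρ))
  ⟪ all φ ⟫ ρ     = ∀ x → ⟪ φ ⟫ (x ∷ ρ)
  ⟪ call φ vs ⟫ ρ = ⟪ φ ⟫ (Vec.map (lookup ρ) vs)

  ⌜⌝-sem : ∀ {n} (φ : Fm n) ρ → ⟦ ⌜ φ ⌝ ⟧ ρ ⟺ ⟪ φ ⟫ ρ
  ⌜⌝-sem (mem i j) ρ = id , id
  ⌜⌝-sem (eq i j) ρ = id , id
  ⌜⌝-sem true ρ = (λ _ → tt) , (λ _ → id)
  ⌜⌝-sem (φ and ψ) ρ = ⟺-trans (∧-sem ⌜ φ ⌝ ⌜ ψ ⌝) (×-⟺ (⌜⌝-sem φ ρ) (⌜⌝-sem ψ ρ))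
  ⌜⌝-sem (φ or ψ) ρ = ⟺-trans (∨-sem ⌜ φ ⌝ ⌜ ψ ⌝) (M-⟺
    ((λ { (inj₁ a) → inj₁ (proj₁ (⌜⌝-sem φ ρ) a) ; (inj₂ b) → inj₂ (proj₁ (⌜⌝-sem ψ ρ) b) }) ,
     (λ { (inj₁ a) → inj₁ (proj₂ (⌜⌝-sem φ ρ) a) ; (inj₂ b) → inj₂ (proj₂ (⌜⌝-sem ψ ρ) b) })))
  ⌜⌝-sem (φ imp ψ) ρ =
    (λ f → proj₁ (⌜⌝-sem ψ ρ) ∘ f ∘ proj₂ (⌜⌝-sem φ ρ)) ,
    (λ f → proj₂ (⌜⌝-sem ψ ρ) ∘ f ∘ proj₁ (⌜⌝-sem φ ρ))
  ⌜⌝-sem (not φ) ρ = (λ f → f ∘ proj₂ (⌜⌝-sem φ ρ)) , (λ f → f ∘ proj₁ (⌜⌝-sem φ ρ))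
  ⌜⌝-sem (ex φ) ρ = ⟺-trans (∃-sem ⌜ φ ⌝) (∃-⟺ λ x → ⌜⌝-sem φ (x ∷ ρ))
  ⌜⌝-sem (all φ) ρ = Π-⟺ λ x → ⌜⌝-sem φ (x ∷ ρ)
  ⌜⌝-sem (call φ vs) ρ = ⟺-trans
    (⟦⟧-sub ⌜ φ ⌝ ρ (Vec.map (lookup ρ) vs) (λ i → sym (lookup-map i (lookup ρ) vs)))
    (⌜⌝-sem φ (Vec.map (lookup ρ) vs))

  ⟪⟫-stable : ∀ {n} (φ : Fm n) {ρ} → M (⟪ φ ⟫ ρ) → ⟪ φ ⟫ ρ
  ⟪⟫-stable φ {ρ} m = proj₁ (⌜⌝-sem φ ρ) (⟦⟧-stable ⌜ φ ⌝ λ k → m (k ∘ proj₂ (⌜⌝-sem φ ρ)))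

  ⟪⟫-resp : ∀ {n} (φ : Fm n) {ρ ρ′} → Pointwise EQ ρ ρ′ → ⟪ φ ⟫ ρ → ⟪ φ ⟫ ρ′
  ⟪⟫-resp (mem i j) e = E-resp (Pointwise.lookup e i) (Pointwise.lookup e j)
  ⟪⟫-resp (eq i j) e h = EQ-trans (EQ-sym (Pointwise.lookup e i)) (EQ-trans h (Pointwise.lookup e j))
  ⟪⟫-resp true e h = h
  ⟪⟫-resp (φ and ψ) e (a , b) = ⟪⟫-resp φ e a , ⟪⟫-resp ψ e b
  ⟪⟫-resp (φ or ψ) e m = m >>= λ
    { (inj₁ a) → return (inj₁ (⟪⟫-resp φ e a)) ; (inj₂ b) → return (inj₂ (⟪⟫-resp ψ e b)) }
  ⟪⟫-resp (φ imp ψ) e f a = ⟪⟫-resp ψ e (f (⟪⟫-resp φ (Pointwise.sym EQ-sym e) a))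
  ⟪⟫-resp (not φ) e f a = f (⟪⟫-resp φ (Pointwise.sym EQ-sym e) a)
  ⟪⟫-resp (ex φ) e m = m >>= λ (x , a) → return (x , ⟪⟫-resp φ (EQ-refl ∷ e) a)
  ⟪⟫-resp (all φ) e f x = ⟪⟫-resp φ (EQ-refl ∷ e) (f x)
  ⟪⟫-resp (call φ vs) e = ⟪⟫-resp φ
    (Pointwise.map⁺ (λ { {i} refl → Pointwise.lookup e i }) (Pointwise.refl {_∼_ = _≡_} refl {vs}))

record Interpretation (L : Signature) : Set where
  field
    eqF  : Fm 2
    relF : (r : Rel L) → Fm (relAr L r)
    funF : (f : Fun L) → Fm (suc (funAr L f))

  translation : Translation L LVS
  translation = record
    { dom = ⊤' ; eqI = ⌜ eqF ⌝ ; relI = λ r → ⌜ relF r ⌝ ; funI = λ f → ⌜ funF f ⌝ }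

module Soundness {L : Signature} (𝓘 : Interpretation L) (𝓢 : Structure) where
  open Interpretation 𝓘
  open Semantics 𝓢
  open Translate translation

  _≈_ : D → D → Set
  x ≈ y = ⟪ eqF ⟫ (x ∷ y ∷ [])

  mutual
    -- The clauses follow `valT`: functions are given by graphs, so a term has a class of values and
    -- not a chosen one.
    Val : ∀ {n} → Term L n → Vec D n → D → Set
    Val (var i)    ρ x = x ≈ lookup ρ i
    Val (app f ts) ρ x = M (∃[ ys ] Vals ts ρ ys × ⟪ funF f ⟫ (x ∷ ys))

    Vals : ∀ {n k} → Vec (Term L n) k → Vec D n → Vec D k → Set
    Vals []       ρ []       = ⊤
    Vals (t ∷ ts) ρ (y ∷ ys) = Val t ρ y × Vals ts ρ ys

  Atom : ∀ {n k} → Fm k → Vec (Term L n) k → Vec D n → Set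
  Atom φ ts ρ = M (∃[ ys ] Vals ts ρ ys × ⟪ φ ⟫ ys)

  _⊨_ : ∀ {n} → Vec D n → Form L n → Set
  ρ ⊨ ⊥'       = Q
  ρ ⊨ (t ≐ s)  = Atom eqF (t ∷ s ∷ []) ρ
  ρ ⊨ rel r ts = Atom (relF r) ts ρ
  ρ ⊨ (φ ⇒ ψ)  = ρ ⊨ φ → ρ ⊨ ψ
  ρ ⊨ ∀' φ     = ∀ x → (x ∷ ρ) ⊨ φ

  conjArgs-sem : ∀ {k m} (φs : Vec (Form LVS (suc m)) k) (ys : Vec D k) (ρ : Vec D m) →
                 ⟦ conjArgs φs ⟧ (ys Vec.++ ρ) ⟺ (∀ j → ⟦ lookup φs j ⟧ (lookup ys j ∷ ρ))
  conjArgs-sem {k} φs ys ρ = ⟺-trans (⋀-sem k _) (Π-⟺ λ j → ⟺-trans (∧-sem ⊤' (subF _ (lookup φs j))) (⟺-trans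
    (proj₂ , (λ a → id , a))
    (⟦⟧-sub (lookup φs j) (ys Vec.++ ρ) (lookup ys j ∷ ρ) λ
      { zero → lookup-++ˡ ys ρ j ; (suc i) → lookup-++ʳ ys ρ i })))

  mutual
    valT-sem : ∀ {n} (t : Term L n) ρ x → ⟦ valT t ⟧ (x ∷ ρ) ⟺ Val t ρ x
    valT-sem (var i) ρ x = ⟺-trans
      (⟦⟧-sub ⌜ eqF ⌝ (x ∷ ρ) (x ∷ lookup ρ i ∷ []) λ { zero → refl ; (suc zero) → refl })
      (⌜⌝-sem eqF _)
    valT-sem (app f ts) ρ x = ⟺-trans (∃ⁿ-sem (funAr L f) _) (∃-⟺ λ ys → ⟺-trans
      (∧-sem (conjArgs (Vec.map (subF _) (valTs ts))) (subF _ ⌜ funF f ⌝))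
      (×-⟺
        (⟺-trans (conjArgs-sem (Vec.map (subF _) (valTs ts)) ys (x ∷ ρ)) (⟺-trans
          (Π-⟺ λ j → ⟺-trans
            (≡-⟺ (cong (λ φ → ⟦ φ ⟧ _) (lookup-map j (subF _) (valTs ts))))
            (⟦⟧-sub (lookup (valTs ts) j) (lookup ys j ∷ x ∷ ρ) (lookup ys j ∷ ρ) λ
              { zero → refl ; (suc i) → refl }))
          (valTs-sem ts ρ ys)))
        (⟺-trans
          (⟦⟧-sub ⌜ funF f ⌝ (ys Vec.++ x ∷ ρ) (x ∷ ys) λ
            { zero → lookup-++ʳ ys (x ∷ ρ) zero ; (suc j) → lookup-++ˡ ys (x ∷ ρ) j })
          (⌜⌝-sem (funF f) _))))

    valTs-sem : ∀ {n k} (ts : Vec (Term L n) k) ρ ys →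
                (∀ j → ⟦ lookup (valTs ts) j ⟧ (lookup ys j ∷ ρ)) ⟺ Vals ts ρ ys
    valTs-sem []       ρ []       = (λ _ → tt) , (λ _ ())
    valTs-sem (t ∷ ts) ρ (y ∷ ys) = ⟺-trans
      ((λ f → f zero , f ∘ suc) , (λ (a , f) → λ { zero → a ; (suc j) → f j }))
      (×-⟺ (valT-sem t ρ y) (valTs-sem ts ρ ys))

  atom-sem : ∀ {n k} (φ : Fm k) (ts : Vec (Term L n) k) ρ → ⟦ atom ⌜ φ ⌝ ts ⟧ ρ ⟺ Atom φ ts ρ
  atom-sem {k = k} φ ts ρ = ⟺-trans (∃ⁿ-sem k _) (∃-⟺ λ ys → ⟺-trans (∧-sem (conjArgs (valTs ts)) (subF _ ⌜ φ ⌝))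
    (×-⟺
      (⟺-trans (conjArgs-sem (valTs ts) ys ρ) (valTs-sem ts ρ ys))
      (⟺-trans (⟦⟧-sub ⌜ φ ⌝ (ys Vec.++ ρ) ys (lookup-++ˡ ys ρ)) (⌜⌝-sem φ ys))))

  tr-sem : ∀ {n} (φ : Form L n) ρ → ⟦ tr φ ⟧ ρ ⟺ ρ ⊨ φ
  tr-sem ⊥'         ρ = id , id
  tr-sem (t ≐ s)    ρ = atom-sem eqF (t ∷ s ∷ []) ρ
  tr-sem (rel r ts) ρ = atom-sem (relF r) ts ρ
  tr-sem (φ ⇒ ψ)    ρ =
    (λ f → proj₁ (tr-sem ψ ρ) ∘ f ∘ proj₂ (tr-sem φ ρ)) ,
    (λ f → proj₂ (tr-sem ψ ρ) ∘ f ∘ proj₁ (tr-sem φ ρ))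
  tr-sem (∀' φ)     ρ = Π-⟺ λ x → ⟺-trans ((λ f → f id) , (λ a _ → a)) (tr-sem φ (x ∷ ρ))

  _≈*_ : ∀ {k} → Vec D k → Vec D k → Set
  _≈*_ = Pointwise _≈_

  -- These laws make the graphs total functions on the quotient by `≈`, as the rules for terms and
  -- equality require.
  record Lawful : Set where
    field
      ≈-refl  : ∀ {x} → x ≈ x
      ≈-sym   : ∀ {x y} → x ≈ y → y ≈ x
      ≈-trans : ∀ {x y z} → x ≈ y → y ≈ z → x ≈ z
      rel-resp : ∀ r {xs ys} → xs ≈* ys → ⟪ relF r ⟫ xs → ⟪ relF r ⟫ ys
      fun-resp : ∀ f {x y xs ys} → x ≈ y → xs ≈* ys → ⟪ funF f ⟫ (x ∷ xs) → ⟪ funF f ⟫ (y ∷ ys)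
      fun-total : ∀ f xs → M (∃[ x ] ⟪ funF f ⟫ (x ∷ xs))
      fun-unique : ∀ f {x y xs} → ⟪ funF f ⟫ (x ∷ xs) → ⟪ funF f ⟫ (y ∷ xs) → x ≈ y

  module Sound (laws : Lawful) where
    open Lawful laws

    ≈*-refl : ∀ {k} {xs : Vec D k} → xs ≈* xs
    ≈*-refl {xs = []}    = []
    ≈*-refl {xs = _ ∷ _} = ≈-refl ∷ ≈*-refl

    Val-resp : ∀ {n} (t : Term L n) {ρ x y} → x ≈ y → Val t ρ x → Val t ρ y
    Val-resp (var i)    e h = ≈-trans (≈-sym e) h
    Val-resp (app f ts) e m = m >>= λ (ys , vs , h) → return (ys , vs , fun-resp f e ≈*-refl h)

    mutual
      Val-unique : ∀ {n} (t : Term L n) {ρ x y} → Val t ρ x → Val t ρ y → x ≈ y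
      Val-unique (var i)    a b = ≈-trans a (≈-sym b)
      Val-unique (app f ts) a b = ⟪⟫-stable eqF (a >>= λ (ys , vs , h) → b >>= λ (zs , ws , k) →
        return (fun-unique f (fun-resp f ≈-refl (Vals-unique ts vs ws) h) k))

      Vals-unique : ∀ {n k} (ts : Vec (Term L n) k) {ρ xs ys} → Vals ts ρ xs → Vals ts ρ ys → xs ≈* ys
      Vals-unique [] {xs = []} {[]} _ _ = []
      Vals-unique (t ∷ ts) {xs = _ ∷ _} {_ ∷ _} (a , as) (b , bs) = Val-unique t a b ∷ Vals-unique ts as bs

    mutual
      Val-total : ∀ {n} (t : Term L n) ρ → M (∃[ x ] Val t ρ x)
      Val-total (var i) ρ = return (lookup ρ i , ≈-refl)
      Val-total (app f ts) ρ = do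
        ys , vs ← Vals-total ts ρ
        x , h ← fun-total f ys
        return (x , return (ys , vs , h))

      Vals-total : ∀ {n k} (ts : Vec (Term L n) k) ρ → M (∃[ xs ] Vals ts ρ xs)
      Vals-total [] ρ = return ([] , tt)
      Vals-total (t ∷ ts) ρ = do
        x , v ← Val-total t ρ
        xs , vs ← Vals-total ts ρ
        return (x ∷ xs , v , vs)

    mutual
      -- At a variable two values of one term are compared, which is where `Val-unique` enters.
      Val-sub : ∀ {m n} (t : Term L m) {σ : Sub m n} {ρ ρ′ x} →
                (∀ i → Val (σ i) ρ (lookup ρ′ i)) → Val (sub σ t) ρ x ⟺ Val t ρ′ x
      Val-sub (var i) {σ} e = (λ v → Val-unique (σ i) v (e i)) , (λ h → Val-resp (σ i) (≈-sym h) (e i))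
      Val-sub (app f ts) e = ∃-⟺ λ ys → ×-⟺ (Vals-sub ts e) (id , id)

      Vals-sub : ∀ {m n k} (ts : Vec (Term L m) k) {σ : Sub m n} {ρ ρ′ xs} →
                 (∀ i → Val (σ i) ρ (lookup ρ′ i)) → Vals (subs σ ts) ρ xs ⟺ Vals ts ρ′ xs
      Vals-sub []       {xs = []}    e = id , id
      Vals-sub (t ∷ ts) {xs = _ ∷ _} e = ×-⟺ (Val-sub t e) (Vals-sub ts e)

    Val-exts : ∀ {m n} {σ : Sub {L} m n} {ρ ρ′} → (∀ i → Val (σ i) ρ (lookup ρ′ i)) →
               ∀ x i → Val (exts σ i) (x ∷ ρ) (lookup (x ∷ ρ′) i)
    Val-exts e x zero = ≈-refl
    Val-exts {σ = σ} e x (suc i) = proj₂ (Val-sub (σ i) (λ _ → ≈-refl)) (e i)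

    ⊨-sub : ∀ {m n} (φ : Form L m) {σ : Sub m n} {ρ ρ′} →
            (∀ i → Val (σ i) ρ (lookup ρ′ i)) → ρ ⊨ subF σ φ ⟺ ρ′ ⊨ φ
    ⊨-sub ⊥' e = id , id
    ⊨-sub (t ≐ s) e = ∃-⟺ λ ys → ×-⟺ (Vals-sub (t ∷ s ∷ []) e) (id , id)
    ⊨-sub (rel r ts) e = ∃-⟺ λ ys → ×-⟺ (Vals-sub ts e) (id , id)
    ⊨-sub (φ ⇒ ψ) e =
      (λ f → proj₁ (⊨-sub ψ e) ∘ f ∘ proj₂ (⊨-sub φ e)) ,
      (λ f → proj₂ (⊨-sub ψ e) ∘ f ∘ proj₁ (⊨-sub φ e))
    ⊨-sub (∀' φ) e = Π-⟺ λ x → ⊨-sub φ (Val-exts e x)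

    ⊨-wk : ∀ {n} (φ : Form L n) {ρ x} → (x ∷ ρ) ⊨ wk φ ⟺ ρ ⊨ φ
    ⊨-wk φ = ⊨-sub φ λ _ → ≈-refl

    ⊨-[] : ∀ {n} (φ : Form L (suc n)) {t ρ x} → Val t ρ x → ρ ⊨ (φ [ t ]) ⟺ (x ∷ ρ) ⊨ φ
    ⊨-[] φ v = ⊨-sub φ λ { zero → v ; (suc i) → ≈-refl }

    ⊨-stable : ∀ {n} (φ : Form L n) {ρ} → M (ρ ⊨ φ) → ρ ⊨ φ
    ⊨-stable φ {ρ} m = proj₁ (tr-sem φ ρ) (⟦⟧-stable (tr φ) λ k → m (k ∘ proj₂ (tr-sem φ ρ)))

    ⊨-≐ : ∀ {n} (t s : Term L n) {ρ x y} → Val t ρ x → Val s ρ y → ρ ⊨ (t ≐ s) ⟺ x ≈ y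
    ⊨-≐ t s {x = x} {y} v w =
      (λ m → ⟪⟫-stable eqF (m >>= λ { (x′ ∷ y′ ∷ [] , (v′ , w′ , _) , e) →
        return (≈-trans (Val-unique t v v′) (≈-trans e (Val-unique s w′ w))) })) ,
      (λ e → return (x ∷ y ∷ [] , (v , w , tt) , e))

    soundness : ∀ {n Γ} {φ : Form L n} → Γ ⊢ φ → ∀ {ρ} → All (ρ ⊨_) Γ → ρ ⊨ φ
    soundness (hyp i) hs = All.lookup hs i
    soundness (⇒I d) hs a = soundness d (a ∷ hs)
    soundness (⇒E d e) hs = soundness d hs (soundness e hs)
    soundness (raa {φ = φ} d) hs = ⊨-stable φ λ k → soundness d (k ∷ hs)
    soundness (∀I d) hs x = soundness d (AllP.gmap⁺ (λ {φ} → proj₂ (⊨-wk φ)) hs)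
    soundness (∀E {φ = φ} d t) {ρ} hs = ⊨-stable (φ [ t ]) (Val-total t ρ >>= λ (x , v) →
      return (proj₂ (⊨-[] φ v) (soundness d hs x)))
    soundness (refl≐ t) {ρ} hs = Val-total t ρ >>= λ (x , v) → proj₂ (⊨-≐ t t v v) ≈-refl
    soundness (subst≐ {t = t} {s} φ d e) {ρ} hs = ⊨-stable (φ [ s ]) (do
      x , v ← Val-total t ρ
      y , w ← Val-total s ρ
      -- Now `s` has the value `x` too, so both instances of `φ` amount to `φ` at `x`.
      let v′ = Val-resp s (≈-sym (proj₁ (⊨-≐ t s v w) (soundness d hs))) w
      return (proj₂ (⊨-[] φ v′) (proj₁ (⊨-[] φ v) (soundness e hs))))
    soundness (close {φ = φ} d) {ρ} hs =
      proj₁ (⊨-wk φ {ρ} {point}) (soundness d (AllP.gmap⁺ (λ {ψ} → proj₂ (⊨-wk ψ)) hs))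

-- The interpreting formulas

-- Variable 0 is a set whose members are exactly variables 1 and 2. Without extensionality there may
-- be several such sets.
two : Fm 3
two = all ((mem 0F 1F imp (eq 0F 2F or eq 0F 3F)) and ((eq 0F 2F or eq 0F 3F) imp mem 0F 1F))

sing : Fm 2
sing = call two (0F ∷ 1F ∷ 1F ∷ [])

zer : Fm 1
zer = all (not (call sing (1F ∷ 0F ∷ [])))

-- The Kuratowski pair {{a}, {a, b}}.
pair : Fm 3
pair = ex (ex (call two (1F ∷ 3F ∷ 3F ∷ []) and (call two (0F ∷ 3F ∷ 4F ∷ []) and call two (2F ∷ 1F ∷ 0F ∷ []))))

entry : Fm 3
entry = ex (mem 0F 1F and call pair (0F ∷ 2F ∷ 3F ∷ []))

-- [ y , w , x ]: some set of pairs containing (y , w) computes w from y by recursion on y,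
-- with value base(w , x) at a zero and step(w″ , w′ , x) at {y″}.
rec : Fm 2 → Fm 3 → Fm 3
rec base step = ex (call entry (0F ∷ 1F ∷ 2F ∷ []) and all (all (call entry (2F ∷ 1F ∷ 0F ∷ []) imp
  ((call zer (1F ∷ []) and call base (0F ∷ 5F ∷ [])) or
   ex (ex (call sing (3F ∷ 1F ∷ []) and
     (call step (0F ∷ 2F ∷ 7F ∷ []) and call entry (4F ∷ 1F ∷ 0F ∷ []))))))))

-- As the step of a recursion, this wraps the previous value in one more singleton.
desc : Fm 3
desc = call sing (1F ∷ 0F ∷ [])

-- Both arguments are stripped of singletons in parallel, and the process can stop only at two
-- zeros.
bis : Fm 2
bis = call (rec (call zer (0F ∷ [])) desc) (0F ∷ 1F ∷ 0F ∷ [])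

-- Bisimilarity may fail to be transitive outside the numerals; being bisimilar to the same objects cannot.
opaque

  eqv : Fm 2
  eqv = all ((call bis (1F ∷ 0F ∷ []) imp call bis (2F ∷ 0F ∷ [])) and
             (call bis (2F ∷ 0F ∷ []) imp call bis (1F ∷ 0F ∷ [])))

-- The local form of the law that successor respects `eqv`; for numerals it is proved in
-- `N-congruent`.
congruent : Fm 1
congruent = all (all (all (call sing (3F ∷ 2F ∷ []) imp (call eqv (2F ∷ 1F ∷ []) imp
  (call sing (0F ∷ 1F ∷ []) imp call eqv (3F ∷ 0F ∷ []))))))

-- The recursion only serves to assert that every iterated predecessor of x is congruent: it pairs
-- each of them with itself.
opaque

  good : Fm 1
  good = ex (call (rec true (desc and call congruent (1F ∷ []))) (1F ∷ 1F ∷ 0F ∷ []))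

-- The closure under `eqv` makes the case distinction in the default of `plus` respect `eqv`.
good* : Fm 1
good* = ex (call eqv (0F ∷ 1F ∷ []) and call good (0F ∷ []))

-- `star` closes a graph under `eqv`; `uniq` keeps a value only if all values are equivalent to it.
star uniq : Fm 3 → Fm 3
star A = ex (ex (ex (call eqv (2F ∷ 3F ∷ []) and (call eqv (1F ∷ 4F ∷ []) and
  (call eqv (0F ∷ 5F ∷ []) and call A (2F ∷ 1F ∷ 0F ∷ []))))))
uniq A = call (star A) (0F ∷ 1F ∷ 2F ∷ []) and
  all (call (star A) (0F ∷ 2F ∷ 3F ∷ []) imp call eqv (0F ∷ 1F ∷ []))

fix : Fm 3 → Fm 3 → Fm 3
fix A δ = uniq A or (not (ex (call (uniq A) (0F ∷ 2F ∷ 3F ∷ []))) and δ)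

-- The default of plus is z if z is not good and y otherwise. The former puts every numeral below such a z,
-- and the latter prevents z + y from being a numeral when y is not.
succ plus times : Fm 3
succ = fix (call sing (0F ∷ 1F ∷ [])) (call eqv (0F ∷ 2F ∷ []))
plus = fix (call good (1F ∷ []) and call (rec eqv desc) (2F ∷ 0F ∷ 1F ∷ []))
  ((not (call good* (1F ∷ [])) and call eqv (0F ∷ 1F ∷ [])) or (call good* (1F ∷ []) and call eqv (0F ∷ 2F ∷ [])))
times = fix (call (rec (call zer (0F ∷ [])) (call plus (1F ∷ 0F ∷ 2F ∷ []))) (2F ∷ 0F ∷ 1F ∷ []))
  (call eqv (0F ∷ 2F ∷ []))

arithmetic : Interpretation LR
arithmetic = record { eqF = eqv ; relF = λ () ; funF = λ
  { zeroF → zer ; succF → call succ (0F ∷ 1F ∷ 1F ∷ []) ; plusF → plus ; timesF → times } }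

-- Finite sets, pairs and coded recursions

module FiniteSets (𝓢 : Structure) (axioms : ∀ ψ → VS ψ → Structure.⟦_⟧ 𝓢 ψ []) where
  open Semantics 𝓢

  Two : D → D → D → Set
  Two x a b = ⟪ two ⟫ (x ∷ a ∷ b ∷ [])

  Sing : D → D → Set
  Sing x y = ⟪ sing ⟫ (x ∷ y ∷ [])

  Zero : D → Set
  Zero x = ⟪ zer ⟫ (x ∷ [])

  Pair Entry : D → D → D → Set
  Pair p a b = ⟪ pair ⟫ (p ∷ a ∷ b ∷ [])
  Entry P y w = ⟪ entry ⟫ (P ∷ y ∷ w ∷ [])

  finite-set : ∀ {n} (us : Vec D n) → M (∃[ x ] ∀ z → E z x ⟺ M (∃[ i ] EQ z (lookup us i)))
  finite-set {n} us = do
    x , h ← proj₁ (∃-sem (∀' (member ⇔' listed)))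
      (∀ᶜ-sem n (∃' (∀' (member ⇔' listed))) (axioms _ (vs-adj n)) us)
    return (x , λ z → ⟺-trans (proj₁ (∧-sem (member ⇒ listed) (listed ⇒ member)) (h z)) (⋁-sem n equal))
    where
    member : Form LVS (suc (suc n))
    member = var 0F ∈' var 1F
    equal : Fin n → Form LVS (suc (suc n))
    equal i = var 0F ≐ var (suc (suc i))
    listed : Form LVS (suc (suc n))
    listed = ⋁ n equal

  two-exists : ∀ a b → M (∃[ x ] Two x a b)
  two-exists a b = do
    x , h ← finite-set (a ∷ b ∷ [])
    return (x , λ z →
      (λ e → proj₁ (h z) e >>= λ { (0F , q) → return (inj₁ q) ; (1F , q) → return (inj₂ q) }) ,
      (λ m → proj₂ (h z) (m >>= λ { (inj₁ q) → return (0F , q) ; (inj₂ q) → return (1F , q) })))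

  sing-exists : ∀ y → M (∃[ x ] Sing x y)
  sing-exists y = two-exists y y

  sing-∈ : ∀ {x y} → Sing x y → E y x
  sing-∈ {y = y} s = proj₂ (s y) (return (inj₁ EQ-refl))

  sing-unique : ∀ {x y z} → Sing x y → Sing x z → EQ y z
  sing-unique {y = y} s s′ = EQ-stable (proj₁ (s′ y) (sing-∈ s) >>= λ
    { (inj₁ e) → return e ; (inj₂ e) → return e })

  zero-exists : M (∃[ x ] Zero x)
  zero-exists = do
    x , h ← finite-set []
    return (x , λ y s → proj₁ (h y) (sing-∈ s) λ ())

  two-injective : ∀ {x x′ a b c d} → EQ x x′ → Two x a b → Two x′ c d →
                  M ((EQ a c × EQ b d) ⊎ (EQ a d × EQ b c))
  two-injective {x} {x′} {a} {b} {c} {d} e h h′ = do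
    inj₁ ac ← proj₁ (h′ a) (E-resp EQ-refl e (proj₂ (h a) (return (inj₁ EQ-refl))))
      where inj₂ ad → do
              inj₁ bc ← b∈x′
                -- Here `a` and `b` both equal `d`, so `c` has to be matched through its membership
                -- in `x`.
                where inj₂ bd → c∈x >>= λ
                        { (inj₁ ca) → return (inj₂ (ad , EQ-trans bd (EQ-trans (EQ-sym ad) (EQ-sym ca))))
                        ; (inj₂ cb) → return (inj₂ (ad , EQ-sym cb)) }
              return (inj₂ (ad , bc))
    inj₁ bc ← b∈x′
      where inj₂ bd → return (inj₁ (ac , bd))
    proj₁ (h d) (E-resp EQ-refl (EQ-sym e) (proj₂ (h′ d) (return (inj₂ EQ-refl)))) >>= λ
      { (inj₁ da) → return (inj₁ (ac , EQ-trans bc (EQ-trans (EQ-sym ac) (EQ-sym da))))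
      ; (inj₂ db) → return (inj₁ (ac , EQ-sym db)) }
    where
    b∈x′ : M (EQ b c ⊎ EQ b d)
    b∈x′ = proj₁ (h′ b) (E-resp EQ-refl e (proj₂ (h b) (return (inj₂ EQ-refl))))
    c∈x : M (EQ c a ⊎ EQ c b)
    c∈x = proj₁ (h c) (E-resp EQ-refl (EQ-sym e) (proj₂ (h′ c) (return (inj₁ EQ-refl))))

  pair-exists : ∀ a b → M (∃[ p ] Pair p a b)
  pair-exists a b = do
    s , hs ← two-exists a a
    t , ht ← two-exists a b
    p , hp ← two-exists s t
    return (p , return (s , return (t , hs , ht , hp)))

  -- Components do not determine a pair, but a pair determines its components, and this suffices for
  -- coding graphs.
  pair-injective : ∀ {p a b c d} → Pair p a b → Pair p c d → M (EQ a c × EQ b d)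
  pair-injective h h′ = do
    s , h₁ ← h
    t , hs , ht , hp ← h₁
    s′ , h₁′ ← h′
    t′ , hs′ , ht′ , hp′ ← h₁′
    inj₁ (s≡s′ , t≡t′) ← two-injective EQ-refl hp hp′
      -- In the crossed case {a} = {c, d}, so `a`, `c` and `d` coincide.
      where inj₂ (s≡t′ , t≡s′) → do
              let ac , ad = ambiguous (two-injective s≡t′ hs ht′)
              inj₁ (_ , bc) ← two-injective t≡s′ ht hs′
                where inj₂ (_ , bc) → return (ac , EQ-trans bc (EQ-trans (EQ-sym ac) ad))
              return (ac , EQ-trans bc (EQ-trans (EQ-sym ac) ad))
    let ac , _ = ambiguous (two-injective s≡s′ hs hs′)
    two-injective t≡t′ ht ht′ >>= λ
      { (inj₁ r) → return r
      ; (inj₂ (ad , bc)) → return (ac , EQ-trans bc (EQ-trans (EQ-sym ac) ad)) }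
    where
    ambiguous : ∀ {a c d} → M ((EQ a c × EQ a d) ⊎ (EQ a d × EQ a c)) → EQ a c × EQ a d
    ambiguous m =
      EQ-stable (m >>= λ { (inj₁ (e , _)) → return e ; (inj₂ (_ , e)) → return e }) ,
      EQ-stable (m >>= λ { (inj₁ (_ , e)) → return e ; (inj₂ (e , _)) → return e })

  pairs-exist : ∀ {n} (ab : Vec (D × D) n) →
                M (∃[ ps ] ∀ i → Pair (lookup ps i) (proj₁ (lookup ab i)) (proj₂ (lookup ab i)))
  pairs-exist [] = return ([] , λ ())
  pairs-exist ((a , b) ∷ ab) = do
    p , h ← pair-exists a b
    ps , hs ← pairs-exist ab
    return (p ∷ ps , λ { zero → h ; (suc i) → hs i })

  pair-resp : ∀ {p q a b} → EQ p q → Pair p a b → Pair q a b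
  pair-resp e = ⟪⟫-resp pair (e ∷ EQ-refl ∷ EQ-refl ∷ [])

  -- One pair is chosen for each item; injectivity of pairs excludes any further entries.
  graph-exists : ∀ {n} (ab : Vec (D × D) n) → M (∃[ P ]
    (∀ i → Entry P (proj₁ (lookup ab i)) (proj₂ (lookup ab i))) ×
    (∀ y w → Entry P y w → M (∃[ i ] EQ (proj₁ (lookup ab i)) y × EQ (proj₂ (lookup ab i)) w)))
  graph-exists ab = do
    ps , hs ← pairs-exist ab
    P , hP ← finite-set ps
    return (P ,
      (λ i → return (lookup ps i , proj₂ (hP _) (return (i , EQ-refl)) , hs i)) ,
      (λ y w m → do
        q , q∈P , hq ← m
        i , e ← proj₁ (hP q) q∈P
        r ← pair-injective (hs i) (pair-resp e hq)
        return (i , r)))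

  sing-resp : ∀ {x x′ y y′} → EQ x x′ → EQ y y′ → Sing x y → Sing x′ y′
  sing-resp e e′ = ⟪⟫-resp sing (e ∷ e′ ∷ [])

  zero-resp : ∀ {x x′} → EQ x x′ → Zero x → Zero x′
  zero-resp e = ⟪⟫-resp zer (e ∷ [])

  module Recursion (base : Fm 2) (step : Fm 3) where

    Base : D → D → Set
    Base w x = ⟪ base ⟫ (w ∷ x ∷ [])

    Step : D → D → D → Set
    Step w″ w′ x = ⟪ step ⟫ (w″ ∷ w′ ∷ x ∷ [])

    Rec : D → D → D → Set
    Rec y w x = ⟪ rec base step ⟫ (y ∷ w ∷ x ∷ [])

    -- The coding set is closed under justification, so it also witnesses the recursion at the
    -- predecessor.
    rec-unfold : ∀ {y w x} → Rec y w x →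
                 M ((Zero y × Base w x) ⊎ (∃[ y″ ] ∃[ w″ ] Sing y y″ × Step w″ w x × Rec y″ w″ x))
    rec-unfold {y} {w} m = do
      P , h , closed ← m
      inj₂ m₁ ← closed y w h
        where inj₁ z → return (inj₁ z)
      y″ , m₂ ← m₁
      w″ , s , t , h″ ← m₂
      return (inj₂ (y″ , w″ , s , t , return (P , h″ , closed)))

    -- A finite computation. `Rec` alone does not guarantee one, since a coding set may contain
    -- endless descents.
    data Trace (x : D) : D → D → Set where
      start  : ∀ {y w} → Zero y → Base w x → Trace x y w
      extend : ∀ {y w y″ w″} → Sing y y″ → Step w″ w x → Trace x y″ w″ → Trace x y w

    Justified : ∀ {n} → D → Vec (D × D) n → D → D → Set
    Justified x ab y w = (Zero y × Base w x) ⊎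
      (∃[ j ] Sing y (proj₁ (lookup ab j)) × Step (proj₂ (lookup ab j)) w x)

    trace-entries : ∀ {x y w} → Trace x y w → ∃[ n ] Σ (Vec (D × D) n) λ ab →
      ∀ i → Justified x ((y , w) ∷ ab) (proj₁ (lookup ((y , w) ∷ ab) i)) (proj₂ (lookup ((y , w) ∷ ab) i))
    trace-entries (start z b) = 0 , [] , λ { 0F → inj₁ (z , b) }
    trace-entries (extend {y″ = y″} {w″} s t tr) with trace-entries tr
    ... | n , ab , h = suc n , (y″ , w″) ∷ ab , λ
      { zero → inj₂ (1F , s , t)
      ; (suc i) → weaken (h i) }
      where
      weaken : ∀ {x y w a n} {ab : Vec (D × D) n} → Justified x ab y w → Justified x (a ∷ ab) y w
      weaken (inj₁ z) = inj₁ z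
      weaken (inj₂ (j , s , t)) = inj₂ (suc j , s , t)

    -- The finitely many entries of the computation form a set; `Base` and `Step` carry over to its
    -- entries because formulas respect `EQ`.
    rec-build : ∀ {x y w} → Trace x y w → Rec y w x
    rec-build {x} tr with trace-entries tr
    ... | n , ab , h = do
      P , entries , listed ← graph-exists (_ ∷ ab)
      return (P , entries 0F , λ y′ w′ e → do
        i , ey , ew ← listed y′ w′ e
        case h i of λ
          { (inj₁ (z , b)) → return (inj₁ (zero-resp ey z ,
              ⟪⟫-resp base (ew ∷ EQ-refl ∷ []) b))
          ; (inj₂ (j , s , t)) → return (inj₂ (return (_ , return (_ , sing-resp ey EQ-refl s ,
              ⟪⟫-resp step (EQ-refl ∷ ew ∷ EQ-refl ∷ []) t , entries j)))) })

-- Total operations from arbitrary relations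

record StableEquivalence (Q D : Set) : Set₁ where
  open Classical Q
  infix 4 _≈_
  field
    _≈_      : D → D → Set
    ≈-refl   : ∀ {x} → x ≈ x
    ≈-sym    : ∀ {x y} → x ≈ y → y ≈ x
    ≈-trans  : ∀ {x y z} → x ≈ y → y ≈ z → x ≈ z
    ≈-stable : ∀ {x y} → M (x ≈ y) → x ≈ y

  transport : ∀ {v v′ w w′} → v ≈ v′ → w ≈ w′ → v ≈ w → v′ ≈ w′
  transport e e′ h = ≈-trans (≈-sym e) (≈-trans h e′)

record Default {Q D : Set} (equivalence : StableEquivalence Q D) : Set₁ where
  open Classical Q
  open StableEquivalence equivalence
  field
    Δ        : D → D → D → Set
    Δ-total  : ∀ a b → M (∃[ w ] Δ w a b)
    Δ-unique : ∀ {v w a b} → Δ v a b → Δ w a b → v ≈ w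
    Δ-resp   : ∀ {w w′ a a′ b b′} → w ≈ w′ → a ≈ a′ → b ≈ b′ → Δ w a b → Δ w′ a′ b′

-- Value is the candidate for Raw that is unique up to ≈, or Δ where there is none: a total operation on
-- ≈-classes whatever Raw is.
module Description {Q D : Set} {equivalence : StableEquivalence Q D} (default : Default equivalence)
                   (Raw : D → D → D → Set) where
  open Classical Q
  open StableEquivalence equivalence
  open Default default

  Star Uniq Value : D → D → D → Set
  Star w a b  = M (∃[ w′ ] M (∃[ a′ ] M (∃[ b′ ] w′ ≈ w × a′ ≈ a × b′ ≈ b × Raw w′ a′ b′)))
  Uniq w a b  = Star w a b × (∀ v → Star v a b → v ≈ w)
  Value w a b = M (Uniq w a b ⊎ ((M (∃[ u ] Uniq u a b) → Q) × Δ w a b))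

  star-intro : ∀ {w a b w′ a′ b′} → w′ ≈ w → a′ ≈ a → b′ ≈ b → Raw w′ a′ b′ → Star w a b
  star-intro e₀ e₁ e₂ r = return (_ , return (_ , return (_ , e₀ , e₁ , e₂ , r)))

  star-elim : ∀ {w a b} → Star w a b →
              M (∃[ w′ ] ∃[ a′ ] ∃[ b′ ] w′ ≈ w × a′ ≈ a × b′ ≈ b × Raw w′ a′ b′)
  star-elim m = do
    w′ , m₁ ← m
    a′ , m₂ ← m₁
    b′ , h ← m₂
    return (w′ , a′ , b′ , h)

  star-resp : ∀ {w w′ a a′ b b′} → w ≈ w′ → a ≈ a′ → b ≈ b′ → Star w a b → Star w′ a′ b′
  star-resp e₀ e₁ e₂ m = star-elim m >>= λ (_ , _ , _ , f₀ , f₁ , f₂ , r) →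
    star-intro (≈-trans f₀ e₀) (≈-trans f₁ e₁) (≈-trans f₂ e₂) r

  uniq-resp : ∀ {w w′ a a′ b b′} → w ≈ w′ → a ≈ a′ → b ≈ b′ → Uniq w a b → Uniq w′ a′ b′
  uniq-resp e₀ e₁ e₂ (s , u) = star-resp e₀ e₁ e₂ s ,
    λ v t → ≈-trans (u v (star-resp ≈-refl (≈-sym e₁) (≈-sym e₂) t)) e₀

  value-resp : ∀ {w w′ a a′ b b′} → w ≈ w′ → a ≈ a′ → b ≈ b′ → Value w a b → Value w′ a′ b′
  value-resp e₀ e₁ e₂ m = m >>= λ
    { (inj₁ u) → return (inj₁ (uniq-resp e₀ e₁ e₂ u))
    ; (inj₂ (n , d)) → return (inj₂
        ( (λ k → n (k >>= λ (u , h) → return (u , uniq-resp ≈-refl (≈-sym e₁) (≈-sym e₂) h)))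
        , Δ-resp e₀ e₁ e₂ d)) }

  value-total : ∀ a b → M (∃[ w ] Value w a b)
  value-total a b = excluded-middle (∃[ w ] Uniq w a b) >>= λ
    { (inj₁ (w , u)) → return (w , return (inj₁ u))
    ; (inj₂ n) → Δ-total a b >>= λ (w , d) → return (w , return (inj₂ ((λ m → m n) , d))) }

  value-unique : ∀ {v w a b} → Value v a b → Value w a b → v ≈ w
  value-unique m m′ = ≈-stable (m >>= λ
    { (inj₁ (s , u)) → m′ >>= λ
        { (inj₁ (_ , u′)) → return (u′ _ s)
        ; (inj₂ (n , _)) → absurd (n (return (_ , s , u))) }
    ; (inj₂ (n , d)) → m′ >>= λ
        { (inj₁ u′) → absurd (n (return (_ , u′)))
        ; (inj₂ (_ , d′)) → return (Δ-unique d d′) } })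

  value-raw : ∀ {w a b} → Raw w a b →
              (∀ {w′ a′ b′} → a′ ≈ a → b′ ≈ b → Raw w′ a′ b′ → w′ ≈ w) → Value w a b
  value-raw r u = return (inj₁
    ( star-intro ≈-refl ≈-refl ≈-refl r
    , λ v s → ≈-stable (star-elim s >>= λ (_ , _ , _ , e₀ , e₁ , e₂ , r′) →
        return (≈-trans (≈-sym e₀) (u e₁ e₂ r′)))))

  -- If all raw values at equivalent arguments lie in one `≈`-class, the description succeeds and
  -- the default is not reached. For numeral arguments `K` will be a class `N n`.
  value-class : (K : D → Set) → (∀ {x} → M (K x) → K x) →
                (∀ {x y} → x ≈ y → K x → K y) → (∀ {x y} → K x → K y → x ≈ y) →
                ∀ {a b} → M (∃[ w ] Raw w a b) →
                (∀ {w a′ b′} → a′ ≈ a → b′ ≈ b → Raw w a′ b′ → K w) →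
                ∀ {v} → Value v a b ⟺ K v
  value-class K K-stable K-resp K-unique {a} {b} m h =
    (λ val → K-stable (m >>= λ (w , r) → return (K-resp (value-unique (value r) val) (h ≈-refl ≈-refl r)))) ,
    (λ k → m >>= λ (w , r) → value-resp (K-unique (h ≈-refl ≈-refl r) k) ≈-refl ≈-refl (value r))
    where
    value : ∀ {w} → Raw w a b → Value w a b
    value r = value-raw r λ e₁ e₂ r′ → K-unique (h e₁ e₂ r′) (h ≈-refl ≈-refl r)

module Defaults {Q D : Set} (equivalence : StableEquivalence Q D) where
  open Classical Q
  open StableEquivalence equivalence

  second : Default equivalence
  second = record
    { Δ = λ w a b → w ≈ b
    ; Δ-total  = λ a b → return (b , ≈-refl)
    ; Δ-unique = λ e e′ → ≈-trans e (≈-sym e′)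
    ; Δ-resp   = λ e₀ _ e₂ → transport e₀ e₂ }

  second-if : (G : D → Set) → (∀ {x y} → x ≈ y → G x → G y) → Default equivalence
  second-if G G-resp = record
    { Δ = λ w a b → M (((G a → Q) × w ≈ a) ⊎ (G a × w ≈ b))
    ; Δ-total  = λ a b → excluded-middle (G a) >>= λ
        { (inj₁ g) → return (b , return (inj₂ (g , ≈-refl)))
        ; (inj₂ n) → return (a , return (inj₁ (n , ≈-refl))) }
    ; Δ-unique = λ m m′ → ≈-stable (m >>= λ
        { (inj₁ (n , e)) → m′ >>= λ
            { (inj₁ (_ , e′)) → return (≈-trans e (≈-sym e′))
            ; (inj₂ (g , _)) → absurd (n g) }
        ; (inj₂ (g , e)) → m′ >>= λ
            { (inj₁ (n , _)) → absurd (n g)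
            ; (inj₂ (_ , e′)) → return (≈-trans e (≈-sym e′)) } })
    ; Δ-resp   = λ e₀ e₁ e₂ m → m >>= λ
        { (inj₁ (n , e)) → return (inj₁ (n ∘ G-resp (≈-sym e₁) , transport e₀ e₁ e))
        ; (inj₂ (g , e)) → return (inj₂ (G-resp e₁ g , transport e₀ e₂ e)) } }

-- Arithmetic of numerals

module Numerals (𝓢 : Structure) (axioms : ∀ ψ → VS ψ → Structure.⟦_⟧ 𝓢 ψ []) where
  open Semantics 𝓢
  open FiniteSets 𝓢 axioms

  -- The height is a number of the metatheory, so induction on it is available.
  Tower : ℕ → (D → Set) → D → Set
  Tower zero    P x = P x
  Tower (suc n) P x = M (∃[ y ] Sing x y × Tower n P y)

  N : ℕ → D → Set
  N n = Tower n Zero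

  tower-map : ∀ n {P P′ : D → Set} → (∀ {u} → P u → P′ u) → ∀ {x} → Tower n P x → Tower n P′ x
  tower-map zero    f t = f t
  tower-map (suc n) f m = m >>= λ (y , s , t) → return (y , s , tower-map n f t)

  tower-+ : ∀ n {m} {P : D → Set} {x} → Tower n (Tower m P) x → Tower (n + m) P x
  tower-+ zero    t = t
  tower-+ (suc n) m = m >>= λ (y , s , t) → return (y , s , tower-+ n t)

  tower-resp : ∀ n {P : D → Set} → (∀ {u v} → EQ u v → P u → P v) →
               ∀ {x y} → EQ x y → Tower n P x → Tower n P y
  tower-resp zero    r e t = r e t
  tower-resp (suc n) r e m = m >>= λ (y , s , t) → return (y , sing-resp e EQ-refl s , t)

  N-resp : ∀ n {x y} → EQ x y → N n x → N n y
  N-resp n = tower-resp n zero-resp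

  N-stable : ∀ n {x} → M (N n x) → N n x
  N-stable zero    {x} m = ⟪⟫-stable zer {x ∷ []} m
  N-stable (suc n) m = m >>= id

  N-pred : ∀ n {x y} → Sing x y → N (suc n) x → N n y
  N-pred n s h = N-stable n (h >>= λ (z , s′ , t) → return (N-resp n (sing-unique s′ s) t))

  N-exists : ∀ n → M (∃[ x ] N n x)
  N-exists zero    = zero-exists
  N-exists (suc n) = do
    y , h ← N-exists n
    x , s ← sing-exists y
    return (x , return (y , s , h))

  N-injective : ∀ m n {x} → N m x → N n x → M (m ≡ n)
  N-injective zero    zero    h k = return refl
  N-injective zero    (suc n) h k = k >>= λ (y , s , _) → absurd (h y s)
  N-injective (suc m) zero    h k = h >>= λ (y , s , _) → absurd (k y s)
  N-injective (suc m) (suc n) h k = h >>= λ (y , s , t) →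
    N-injective m n t (N-pred n s k) >>= λ e → return (cong suc e)

  -- Up to `n` singletons are peeled off; an early stop occurs at a non-singleton, which counts as a
  -- zero.
  split : ∀ n x → M ((∃[ k ] k < n × N k x) ⊎ (∃[ z ] Tower n (EQ z) x))
  split zero x = return (inj₂ (x , EQ-refl))
  split (suc n) x = do
    inj₁ (y , s) ← excluded-middle (∃[ y ] Sing x y)
      where inj₂ z → return (inj₁ (0 , s≤s z≤n , λ y s → z (y , s)))
    inj₁ (k , k<n , h) ← split n y
      where inj₂ (z , t) → return (inj₂ (z , return (y , s , t)))
    return (inj₁ (suc k , s≤s k<n , return (y , s , h)))

  module Descent (base : Fm 2) where
    open Recursion base desc public

    -- The numeral `y` dictates which case of the recursion applies, so exactly `n` singletons are
    -- built over a base value.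
    rec⇒tower : ∀ n {y w x} → N n y → Rec y w x → M (Tower n (λ u → Base u x) w)
    rec⇒tower n {y} h r = do
      inj₁ (z , b) ← rec-unfold r
        where inj₂ (_ , _ , s , s′ , r′) → descend n h s s′ r′
      stop n h z b
      where
      stop : ∀ n {y w x} → N n y → Zero y → Base w x → M (Tower n (λ u → Base u x) w)
      stop zero    h z b = return b
      stop (suc n) h z b = h >>= λ (y′ , s , _) → absurd (z y′ s)
      descend : ∀ n {y w x y″ w″} → N n y → Sing y y″ → Sing w w″ → Rec y″ w″ x → M (Tower n (λ u → Base u x) w)
      descend zero    h s s′ r = absurd (h _ s)
      descend (suc n) h s s′ r = rec⇒tower n (N-pred n s h) r >>= λ t → return (return (_ , s′ , t))

    tower-trace : ∀ n {y w x} → N n y → Tower n (λ u → Base u x) w → M (Trace x y w)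
    tower-trace zero    h b = return (start h b)
    tower-trace (suc n) h m = do
      y″ , s , h′ ← h
      w″ , s′ , t ← m
      tr ← tower-trace n h′ t
      return (extend s s′ tr)

    tower⇒rec : ∀ n {y w x} → N n y → Tower n (λ u → Base u x) w → Rec y w x
    tower⇒rec n h t = tower-trace n h t >>= rec-build

    -- Here the value is the numeral. Each step strips a singleton from it as well as from `y`, so
    -- the recursion stops after `k` steps and leaves `j` singletons in the base value.
    rec-bounded : ∀ n {y w x} → N n w → Rec y w x →
                  M (∃[ k ] ∃[ j ] k + j ≡ n × N k y × (∃[ u ] N j u × Base u x))
    rec-bounded n h r = rec-unfold r >>= λ
      { (inj₁ (z , b)) → return (0 , n , refl , z , _ , h , b)
      ; (inj₂ (_ , _ , s , s′ , r′)) → descend n h s s′ r′ }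
      where
      descend : ∀ n {y w x y″ w″} → N n w → Sing y y″ → Sing w w″ → Rec y″ w″ x →
                M (∃[ k ] ∃[ j ] k + j ≡ n × N k y × (∃[ u ] N j u × Base u x))
      descend zero    h s s′ r = absurd (h _ s′)
      descend (suc n) h s s′ r = rec-bounded n (N-pred n s′ h) r >>= λ (k , j , e , hk , u , hj , b) →
        return (suc k , j , cong suc e , return (_ , s , hk) , u , hj , b)

  -- Bisimilarity and equality of numerals

  module Bis = Descent (call zer (0F ∷ []))

  bisimilar : ∀ n {x z} → N n x → ⟪ bis ⟫ (x ∷ z ∷ []) ⟺ N n z
  bisimilar n {x} h = (λ r → N-stable n (Bis.rec⇒tower n {x = x} h r)) , Bis.tower⇒rec n {x = x} h

  opaque
    unfolding eqv

    eqv-intro : ∀ {x y} → (∀ z → ⟪ bis ⟫ (x ∷ z ∷ []) ⟺ ⟪ bis ⟫ (y ∷ z ∷ [])) → ⟪ eqv ⟫ (x ∷ y ∷ [])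
    eqv-intro h = h

    eqv-elim : ∀ {x y} → ⟪ eqv ⟫ (x ∷ y ∷ []) → ∀ z → ⟪ bis ⟫ (x ∷ z ∷ []) ⟺ ⟪ bis ⟫ (y ∷ z ∷ [])
    eqv-elim h = h

  equivalence : StableEquivalence Q D
  equivalence = record
    { _≈_      = λ x y → ⟪ eqv ⟫ (x ∷ y ∷ [])
    ; ≈-refl   = eqv-intro λ _ → id , id
    ; ≈-sym    = λ e → eqv-intro λ z → proj₂ (eqv-elim e z) , proj₁ (eqv-elim e z)
    ; ≈-trans  = λ e e′ → eqv-intro λ z → ⟺-trans (eqv-elim e z) (eqv-elim e′ z)
    ; ≈-stable = ⟪⟫-stable eqv }

  open StableEquivalence equivalence public

  EQ⇒≈ : ∀ {x y} → EQ x y → x ≈ y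
  EQ⇒≈ e = ⟪⟫-resp eqv (EQ-refl ∷ e ∷ []) ≈-refl

  N⇒≈ : ∀ n {x y} → N n x → N n y → x ≈ y
  N⇒≈ n h k = eqv-intro λ z →
    (λ r → proj₂ (bisimilar n k) (proj₁ (bisimilar n h) r)) ,
    (λ r → proj₂ (bisimilar n h) (proj₁ (bisimilar n k) r))

  -- Since `x` is bisimilar to itself, `y` is bisimilar to `x`, and `rec-bounded` makes `y` a
  -- numeral. The base value is a zero, so nothing of `n` is left over.
  N-≈ : ∀ n {x y} → x ≈ y → N n x → N n y
  N-≈ n {x} {y} e h = N-stable n (do
    k , j , e′ , hk , u , hj , z ← Bis.rec-bounded n {x = y} h (proj₁ (eqv-elim e x) (proj₂ (bisimilar n h) h))
    refl ← N-injective j 0 hj z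
    return (subst (λ i → N i y) (trans (sym (+-identityʳ k)) e′) hk))

  -- Good objects

  Congruent : D → Set
  Congruent c = ⟪ congruent ⟫ (c ∷ [])

  N-congruent : ∀ n {c} → N n c → Congruent c
  N-congruent zero    h y y′ c′ s _ _ = ≈-stable (absurd (h y s))
  N-congruent (suc n) h y y′ c′ s e s′ = N⇒≈ (suc n) h (return (y′ , s′ , N-≈ n e (N-pred n s h)))

  module Goodness = Recursion true (desc and call congruent (1F ∷ []))

  Good : D → Set
  Good x = ⟪ good ⟫ (x ∷ [])

  opaque
    unfolding good

    good-intro : ∀ {x p} → Goodness.Rec x x p → Good x
    good-intro {p = p} r = return (p , r)

    good-elim : ∀ {x} → Good x → M (∃[ p ] Goodness.Rec x x p)
    good-elim g = g

  good-trace : ∀ n {p x} → N n x → M (Goodness.Trace p x x)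
  good-trace zero    h = return (Goodness.start h tt)
  good-trace (suc n) h = do
    y , s , h′ ← h
    tr ← good-trace n h′
    return (Goodness.extend s (s , N-congruent (suc n) h) tr)

  N-good : ∀ n {x} → N n x → Good x
  N-good n {x} h = ⟪⟫-stable good (good-trace n {p = x} h >>= λ tr →
    return (good-intro {p = x} (Goodness.rec-build tr)))

  -- A singleton determines its member up to `EQ`, so the recursion stays on the diagonal and
  -- continues at `(y , y)`.
  good-pred : ∀ {x y} → Sing x y → Good x → M (Good y × Congruent x)
  good-pred {x} {y} s g = do
    p , r ← good-elim g
    inj₂ (y″ , w″ , s″ , (t″ , c) , r″) ← Goodness.rec-unfold {x = p} r
      where inj₁ (z , _) → absurd (z y s)
    return (good-intro {p = p} (⟪⟫-resp (rec true (desc and call congruent (1F ∷ [])))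
      (sing-unique s″ s ∷ sing-unique t″ s ∷ EQ-refl {p} ∷ []) r″) , c)

  good-tower : ∀ n {x z} → Good x → Tower n (EQ z) x → M (Good z)
  good-tower zero    g e = return (⟪⟫-resp good (EQ-sym e ∷ []) g)
  good-tower (suc n) g t = do
    y , s , t′ ← t
    g′ , _ ← good-pred s g
    good-tower n g′ t′

  -- Goodness of `x` supplies congruence at every level, which lifts the equivalence from the bottom
  -- of the towers to the top.
  tower-cong : ∀ n {x v z} → Good x → Tower n (EQ z) x → Tower n (_≈ z) v → v ≈ x
  tower-cong zero    g e e′ = ≈-trans e′ (EQ⇒≈ e)
  tower-cong (suc n) {v = v} g t t′ = ≈-stable (do
    y , s , u ← t
    y′ , s′ , u′ ← t′
    g′ , c ← good-pred s g
    return (≈-sym (c y y′ v s (≈-sym (tower-cong n g′ u u′)) s′)))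

  -- The operations on numerals

  module Succ = Description (Defaults.second equivalence) (λ w x _ → Sing w x)

  succ-numeral : ∀ n {x} → N n x → ∀ {w} → Succ.Value w x x ⟺ N (suc n) w
  succ-numeral n {x} h =
    Succ.value-class (N (suc n)) (N-stable (suc n)) (N-≈ (suc n)) (N⇒≈ (suc n)) {x} {x} (sing-exists x)
    λ {_} {a′} e _ s → return (a′ , s , N-≈ n (≈-sym e) h)

  Good* : D → Set
  Good* z = ⟪ good* ⟫ (z ∷ [])

  good*-intro : ∀ {z} → Good z → Good* z
  good*-intro g = return (_ , ≈-refl , g)

  good*-resp : ∀ {z z′} → z ≈ z′ → Good* z → Good* z′
  good*-resp e m = m >>= λ (y , f , g) → return (y , ≈-trans f e , g)

  module Plus = Description (Defaults.second-if equivalence Good* (good*-resp))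
    (λ w z y → Good z × ⟪ rec eqv desc ⟫ (y ∷ w ∷ z ∷ []))

  module Sum = Descent eqv

  -- The recursion runs along `y` and puts `n` singletons over an object equivalent to `z`; hence
  -- the order `n + m`.
  plus-numeral : ∀ m n {z y} → N m z → N n y → ∀ {w} → Plus.Value w z y ⟺ N (n + m) w
  plus-numeral m n {z} {y} hz hy =
    Plus.value-class (N (n + m)) (N-stable (n + m)) (N-≈ (n + m)) (N⇒≈ (n + m)) {z} {y}
    (do
      w , t ← tower-exists n z
      return (w , N-good m hz , Sum.tower⇒rec n {x = z} hy t))
    λ {_} {z′} e₁ e₂ (_ , r) → N-stable (n + m) (do
      t ← Sum.rec⇒tower n {x = z′} (N-≈ n (≈-sym e₂) hy) r
      return (tower-+ n (tower-map n (λ f → N-≈ m (≈-sym (≈-trans f e₁)) hz) t)))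
    where
    tower-exists : ∀ n z → M (∃[ w ] Tower n (_≈ z) w)
    tower-exists zero    z = return (z , ≈-refl)
    tower-exists (suc n) z = do
      y , t ← tower-exists n z
      x , s ← sing-exists y
      return (x , return (y , s , t))

  plus-bounded : ∀ n {w z x} → N n w → Plus.Value w z x → M (∃[ k ] k ≤ n × N k x)
  plus-bounded n h m = m >>= λ
    { (inj₁ (s , _)) → Plus.star-elim s >>= λ (w′ , z′ , x′ , e₀ , _ , e₂ , _ , r) →
        Sum.rec-bounded n {x = z′} (N-≈ n (≈-sym e₀) h) r >>= λ (k , j , e , hk , _) →
        return (k , subst (k ≤_) e (m≤m+n k j) , N-≈ k e₂ hk)
    ; (inj₂ (_ , d)) → d >>= λ
      -- The default `z` is impossible: it would be a numeral, hence good. The other default is `x`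
      -- itself.
      { (inj₁ (b , e)) → absurd (b (good*-intro (N-good n (N-≈ n e h))))
      ; (inj₂ (_ , e)) → return (n , ≤-refl , N-≈ n e h) } }

  plus-tower : ∀ n {x z y} → Good x → Tower n (EQ z) x → N n y → M (Plus.Value x z y)
  plus-tower n {z = z} g t h = good-tower n g t >>= λ g′ → return (Plus.value-raw
    (g′ , Sum.tower⇒rec n {x = z} h (tower-map n (λ e → ≈-sym (EQ⇒≈ e)) t))
    λ {_} {z′} e₁ e₂ (_ , r) → ≈-stable (do
      u ← Sum.rec⇒tower n {x = z′} (N-≈ n (≈-sym e₂) h) r
      return (tower-cong n g t (tower-map n (λ e → ≈-trans e e₁) u))))

  plus-difference : ∀ n {y} → N n y → ∀ x →
                     M ((∃[ k ] k < n × N k x) ⊎ (∃[ z ] Plus.Value x z y))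
  plus-difference n {y} h x = excluded-middle (Good* x) >>= λ
    { (inj₁ m) → m >>= λ (x′ , e , g) → split n x′ >>= λ
      { (inj₁ (k , k<n , hk)) → return (inj₁ (k , k<n , N-≈ k e hk))
      ; (inj₂ (z , t)) → plus-tower n g t h >>= λ p → return (inj₂ (z ,
          Plus.value-resp e ≈-refl ≈-refl p)) }
    -- No raw sum starts from an object equivalent to `x`, so the default gives `x + y = x` and `x`
    -- serves as `z`.
    ; (inj₂ b) → return (inj₂ (x , return (inj₂
        ( (λ m → m λ (u , s , _) → Plus.star-elim s λ (_ , x′ , _ , _ , e , _ , g , _) →
            b (return (x′ , e , g)))
        , return (inj₁ (b , ≈-refl)))))) }

  -- Multiplication uses addition only through its values on numerals.
  module Product (step : Fm 3) (step-numeral : ∀ m n {z y} → N m z → N n y →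
                                               ∀ {w} → ⟪ step ⟫ (z ∷ w ∷ y ∷ []) ⟺ N (n + m) w) where
    open Recursion (call zer (0F ∷ [])) step public

    rec-numeral : ∀ m n {x y w} → N m x → N n y → Rec y w x → M (N (n * m) w)
    rec-numeral m n {x} hx hy r = rec-unfold r >>= λ
      { (inj₁ (z , b)) → stop n hy z b
      ; (inj₂ (y″ , w″ , s , t , r′)) → descend n hy s t r′ }
      where
      stop : ∀ n {y w} → N n y → Zero y → Zero w → M (N (n * m) w)
      stop zero    h z b = return b
      stop (suc n) h z b = h >>= λ (y′ , s , _) → absurd (z y′ s)
      descend : ∀ n {y w y″ w″} → N n y → Sing y y″ → Step w″ w x → Rec y″ w″ x → M (N (n * m) w)
      descend zero    h s t r = absurd (h _ s)
      descend (suc n) h s t r =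
        rec-numeral m n hx (N-pred n s h) r >>= λ h″ → return (proj₁ (step-numeral (n * m) m h″ hx) t)

    numeral-trace : ∀ m n {x y} → N m x → N n y → M (∃[ w ] N (n * m) w × Trace x y w)
    numeral-trace m zero    hx hy = zero-exists >>= λ (w , z) → return (w , z , start hy z)
    numeral-trace m (suc n) hx hy = do
      y″ , s , h ← hy
      w″ , h″ , tr ← numeral-trace m n hx h
      w , hw ← N-exists (m + n * m)
      return (w , hw , extend s (proj₂ (step-numeral (n * m) m h″ hx) hw) tr)

  module PlusProduct = Product (call plus (1F ∷ 0F ∷ 2F ∷ [])) plus-numeral

  module Times = Description (Defaults.second equivalence) (λ w x y → PlusProduct.Rec y w x)

  times-numeral : ∀ m n {x y} → N m x → N n y → ∀ {w} → Times.Value w x y ⟺ N (n * m) w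
  times-numeral m n {x} {y} hx hy =
    Times.value-class (N (n * m)) (N-stable (n * m)) (N-≈ (n * m)) (N⇒≈ (n * m)) {x} {y}
    (PlusProduct.numeral-trace m n hx hy >>= λ (w , _ , tr) → return (w , PlusProduct.rec-build {x} {y} {w} tr))
    λ {w} {x′} {y′} e₁ e₂ r → N-stable (n * m)
      (PlusProduct.rec-numeral m n {x′} {y′} {w} (N-≈ m (≈-sym e₁) hx) (N-≈ n (≈-sym e₂) hy) r)

  -- Verification of the axioms of R

  open Interpretation arithmetic using (translation)
  open Soundness arithmetic 𝓢 using (Val; _⊨_; tr-sem; Lawful; module Sound)

  laws : Lawful
  laws = record
    { ≈-refl     = ≈-refl
    ; ≈-sym      = ≈-sym
    ; ≈-trans    = ≈-trans
    ; rel-resp   = λ ()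
    ; fun-resp   = λ
        { zeroF e [] z → N-≈ 0 e z
        ; succF {xs = _ ∷ []} {_ ∷ []} e (e₁ ∷ []) → Succ.value-resp e e₁ e₁
        ; plusF {xs = _ ∷ _ ∷ []} {_ ∷ _ ∷ []} e (e₁ ∷ e₂ ∷ []) → Plus.value-resp e e₁ e₂
        ; timesF {xs = _ ∷ _ ∷ []} {_ ∷ _ ∷ []} e (e₁ ∷ e₂ ∷ []) → Times.value-resp e e₁ e₂ }
    ; fun-total  = λ
        { zeroF [] → zero-exists
        ; succF (a ∷ []) → Succ.value-total a a
        ; plusF (a ∷ b ∷ []) → Plus.value-total a b
        ; timesF (a ∷ b ∷ []) → Times.value-total a b }
    ; fun-unique = λ
        { zeroF {xs = []} → N⇒≈ 0
        ; succF {x} {y} {a ∷ []} → Succ.value-unique {x} {y} {a} {a}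
        ; plusF {x} {y} {a ∷ b ∷ []} → Plus.value-unique {x} {y} {a} {b}
        ; timesF {x} {y} {a ∷ b ∷ []} → Times.value-unique {x} {y} {a} {b} } }

  open Sound laws using (⊨-≐; ⊨-stable; Val-sub; soundness)

  Val-num : ∀ n {m} {ρ : Vec D m} {x} → Val (num n) ρ x ⟺ N n x
  Val-num zero =
    (λ m → N-stable 0 (m >>= λ { ([] , _ , z) → return z })) ,
    (λ z → return ([] , tt , z))
  Val-num (suc n) =
    (λ m → N-stable (suc n) (m >>= λ { (y ∷ [] , (v , _) , s) →
      return (proj₁ (succ-numeral n (proj₁ (Val-num n) v)) s) })) ,
    (λ h → h >>= λ (y , s , h′) →
      return (y ∷ [] , (proj₂ (Val-num n) h′ , tt) , proj₂ (succ-numeral n h′) h))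

  Val-wk-num : ∀ n {m} {ρ : Vec D m} {z x} → N n x → Val (wkT (num n)) (z ∷ ρ) x
  Val-wk-num n {ρ = ρ} h =
    proj₂ (Val-sub (num n) {ρ′ = ρ} (λ i → ≈-refl)) (proj₂ (Val-num n) h)

  ⊨-⋁ : ∀ k (φ : Fin k → Form LR 1) {ρ} i → ρ ⊨ φ i → ρ ⊨ ⋁ k φ
  ⊨-⋁ (suc k) φ zero    h n = ⊨-stable (⋁ k (φ ∘ suc)) (absurd (n h))
  ⊨-⋁ (suc k) φ (suc i) h n = ⊨-⋁ k (φ ∘ suc) i h

  ≤-intro : ∀ {x} (s t : Term LR 1) {z a b} → Val (wkT s) (z ∷ x ∷ []) a → Val (wkT t) (z ∷ x ∷ []) b →
            Plus.Value b z a → (x ∷ []) ⊨ (s ≤' t)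
  ≤-intro s t {z} {a} {b} v w p k = k z (proj₂ (⊨-≐ (var zero ⊕ wkT s) (wkT t) {y = b}
    (return (z ∷ a ∷ [] , (≈-refl , v , tt) , p)) w) ≈-refl)

  R-sound : ∀ φ → R φ → [] ⊨ φ
  R-sound _ (r-plus m n) = ⊨-stable ((num m ⊕ num n) ≐ num (m + n)) (do
    x , hx ← N-exists m
    y , hy ← N-exists n
    w , hw ← N-exists (m + n)
    return (proj₂ (⊨-≐ (num m ⊕ num n) (num (m + n)) {y = w}
      (return (x ∷ y ∷ [] , (proj₂ (Val-num m) hx , proj₂ (Val-num n) hy , tt) ,
        proj₂ (plus-numeral m n hx hy) (subst (λ k → N k w) (+-comm m n) hw)))
      (proj₂ (Val-num (m + n)) hw)) ≈-refl))
  R-sound _ (r-times m n) = ⊨-stable ((num m ⊗ num n) ≐ num (m * n)) (do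
    x , hx ← N-exists m
    y , hy ← N-exists n
    w , hw ← N-exists (m * n)
    return (proj₂ (⊨-≐ (num m ⊗ num n) (num (m * n)) {y = w}
      (return (x ∷ y ∷ [] , (proj₂ (Val-num m) hx , proj₂ (Val-num n) hy , tt) ,
        proj₂ (times-numeral m n hx hy) (subst (λ k → N k w) (*-comm m n) hw)))
      (proj₂ (Val-num (m * n)) hw)) ≈-refl))
  R-sound _ (r-neq m n m≢n) h = (do
    x , hx ← N-exists m
    y , hy ← N-exists n
    let e = proj₁ (⊨-≐ (num m) (num n) {x = x} {y} (proj₂ (Val-num m) hx) (proj₂ (Val-num n) hy)) h
    m≡n ← N-injective m n (N-≈ m e hx) hy
    return (m≢n m≡n)) ⊥-elim
  R-sound _ (r-bound n) x h = ⊨-stable (⋁ (suc n) (λ k → var zero ≐ num (toℕ k))) λ k → h λ z e → (do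
    y , hy ← N-exists n
    w , p ← Plus.value-total z x
    let w≈y = proj₁ (⊨-≐ (var zero ⊕ wkT (var zero)) (wkT (num n)) {x = w} {y}
          (return (z ∷ x ∷ [] , (≈-refl , ≈-refl , tt) , p)) (Val-wk-num n hy)) e
    i , i≤n , hx ← plus-bounded n (N-≈ n (≈-sym w≈y) hy) p
    let j = fromℕ< (s≤s i≤n)
    return (⊨-⋁ (suc n) (λ k → var zero ≐ num (toℕ k)) j
      (proj₂ (⊨-≐ (var zero) (num (toℕ j)) {x = x} {x} ≈-refl
        (proj₂ (Val-num (toℕ j)) (subst (λ k → N k x) (sym (toℕ-fromℕ< (s≤s i≤n))) hx))) ≈-refl))) k
  R-sound _ (r-total n) x = ⊨-stable ((var zero ≤' num n) ∨' (num n ≤' var zero)) (do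
    y , hy ← N-exists n
    inj₁ (k , k<n , hx) ← plus-difference n hy x
      where inj₂ (z , p) → return λ _ → ≤-intro (num n) (var zero) {z} {y} {x} (Val-wk-num n hy) ≈-refl p
    -- The summand that takes the numeral `k` up to `n`.
    z , hz ← N-exists (n ∸ k)
    let hy′ = subst (λ i → N i y) (sym (m+[n∸m]≡n (<⇒≤ k<n))) hy
        ≤n = ≤-intro (var zero) (num n) {z} {x} {y} ≈-refl (Val-wk-num n hy)
               (proj₂ (plus-numeral (n ∸ k) k hz hx) hy′)
    return λ n≰ → ⊨-stable (num n ≤' var zero) (absurd (n≰ ≤n)))

  interpretation-sound : ∀ φ → R ⊩ φ → ⟦ Translate.tr translation φ ⟧ []
  interpretation-sound φ (Γ , rs , d) =
    proj₂ (tr-sem φ []) (soundness d (All.map (λ {ψ} → R-sound ψ) rs))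

theorem2p2 : OneDimInterprets VS R
theorem2p2 = Interpretation.translation arithmetic , λ φ r →
  -- The structure is built for each `φ` separately, its falsum being provability of the translation
  -- of `φ`.
  let open Completeness VS (Translate.tr (Interpretation.translation arithmetic) φ)
  in completeness λ axioms → Numerals.interpretation-sound model axioms φ r
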